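{- Let $L$ be a lattice with transfer multiplicity one, and suppose that in both directions the transfer matrices are the same real symmetric matrix, i.e. for every $m\ge 1$ the transfer matrix for gluing columns with $m+1$ entries and the transfer matrix for gluing rows with $m+1$ entries are equal (same index set of $0/1$-vectors, same entries) and symmetric. Then the entropy constants of $L$ on the plane, on the cylinder and on the torus are the same: the limits $$\lim_{m,n\to\infty} i(G_{m,n})^{1/|V(G_{m,n})|},\qquad \lim_{m,n\to\infty} i(H_{n,m})^{1/|V(H_{n,m})|},\qquad \lim_{m,n\to\infty} i(S_{n,m})^{1/|V(S_{n,m})|}$$ exist and are equal, where $i(\cdot)$ denotes the number of independent sets.
   Context: A lattice $L$ is given as a graph with vertex set $\{(i,j): i,j\in\mathbb Z_{\ge 0}\}$ ($i$ = row, $j$ = column). For positive integers $m,n$, the plane lattice graph $G_{m,n}$ is the subgraph of $L$ induced on $\{0,\dots,m\}\times\{0,\dots,n\}$, so its vertices are arranged in $m+1$ rows and $n+1$ columns. An independent set (the empty set included) is recorded column by column by $0/1$-vectors of length $m+1$, or row by row by $0/1$-vectors of length $n+1$. Transfer matrix for gluing columns: assume every edge of $L$ joins vertices in the same column or in consecutive columns. For a step $j\to j+1$, the transfer matrix has rows (resp. columns) indexed by the vectors in $\{0,1\}^{m+1}$ representing independent sets inside column $j$ (resp. column $j+1$) restricted to rows $0,\dots,m$. Its entry at $(\alpha,\beta)$ is $1$ if placing $\alpha$ in column $j$ and $\beta$ in column $j+1$ gives an independent set, and $0$ otherwise. The transfer matrix for gluing rows is defined in the same way with the roles of rows and columns exchanged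 (every edge joins vertices in the same row or consecutive rows). The lattice has transfer multiplicity one if, for each vector length, a single matrix (with a single index set) serves as the transfer matrix for all steps $j\to j+1$, in the column direction and likewise in the row direction. Cylinder and torus: $H_{n,m}$ is the graph obtained from $G_{m,n}$ by identifying its leftmost column with its rightmost column, $(i,0)\sim(i,n)$ for all $i$. $S_{n,m}$ is the graph obtained from $H_{n,m}$ by identifying its top row with its bottom row, $(0,j)\sim(m,j)$ for all $j$. Multiple edges are irrelevant, and a vertex carrying a loop belongs to no independent set. Thus $|V(G_{m,n})|=(m+1)(n+1)$, $|V(H_{n,m})|=(m+1)n$, $|V(S_{n,m})|=mn$. The limits $m,n\to\infty$ are double limits with $m$ and $n$ tending to infinity independently. -}

module Defs where

import Algebra.Definitions.RawSemiring
open import Data.Bool using (Bool; true; false; T; if_then_else_)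
open import Data.Bool.Properties using (T?)
open import Data.Empty using (⊥; ⊥-elim)
open import Data.Fin using (Fin; zero; suc; toℕ)
import Data.Fin.Properties as Fin
open import Data.Integer using (+_)
open import Data.List using (List; []; _∷_; length; filter; cartesianProductWith)
open import Data.Nat as ℕ using (ℕ; zero; suc; NonZero; ∣_-_∣)
open import Data.Nat.DivMod using (_mod_)
import Data.Nat.Properties as ℕ
open import Data.Product using (∃; _×_; _,_)
open import Data.Product.Properties using (≡-dec)
open import Data.Rational
  using (ℚ; 0ℚ; 1ℚ; _+_; _*_; _-_; -_; _/_; _<_; _≤_; _⊓_; _⊔_; 1/_; positive; nonNegative)
open import Data.Rational.Base using (+-*-rawSemiring)
open import Data.Rational.Properties
open import Data.Sum using (_⊎_; inj₁; inj₂)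
open import Data.Vec using (Vec; []; _∷_; lookup)
open import Level using (0ℓ)
open import Relation.Binary.Core using (Rel)
open import Relation.Binary.Definitions
  using (Symmetric; Decidable; DecidableEquality; tri<; tri≈; tri>)
open import Relation.Binary.PropositionalEquality
  using (_≡_; _≗_; refl; sym; trans; cong; subst)
open import Relation.Nullary using (Dec; yes; no; ¬_; does)
open import Relation.Nullary.Decidable using (map′; _×-dec_; _→-dec_; ¬?)
import Relation.Unary as U

open Algebra.Definitions.RawSemiring +-*-rawSemiring public using (_^_)

record ℝ : Set₁ where
  field
    Lower Upper     : ℚ → Set
    lower-inhabited : ∃ Lower
    upper-inhabited : ∃ Upper
    lower-closed    : ∀ {p q} → p < q → Lower q → Lower p
    upper-closed    : ∀ {p q} → p < q → Upper p → Upper q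
    lower-open      : ∀ {p} → Lower p → ∃ λ q → p < q × Lower q
    upper-open      : ∀ {q} → Upper q → ∃ λ p → p < q × Upper p
    disjoint        : ∀ {q} → Lower q → Upper q → ⊥
    located         : ∀ {p q} → p < q → Lower p ⊎ Upper q

open ℝ public

infix 4 _<_+ℚ_

-- x < y +ℚ ε means x < y + ε, with the strict order of ℝ: some rational q has
-- x < q and q - ε < y.
_<_+ℚ_ : ℝ → ℝ → ℚ → Set
x < y +ℚ ε = ∃ λ q → Upper x q × Lower y (q - ε)

-- ∣ x - y ∣ < ε
Within : ℚ → ℝ → ℝ → Set
Within ε x y = (x < y +ℚ ε) × (y < x +ℚ ε)

DoubleSequence : Set₁
DoubleSequence = (m n : ℕ) .{{_ : NonZero m}} .{{_ : NonZero n}} → ℝ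

infix 4 _⟶_

_⟶_ : DoubleSequence → ℝ → Set
a ⟶ ℓ = ∀ ε → 0ℚ < ε → ∃ λ N →
        ∀ m n .{{_ : NonZero m}} .{{_ : NonZero n}} →
        N ℕ.≤ m → N ℕ.≤ n → Within ε (a m n) ℓ

private
  quotient-exists : ∀ c y → 0ℚ < y → ∃ λ z → z * y ≡ c
  quotient-exists c y 0<y = c * z , (begin
      c * z * y    ≡⟨ *-assoc c z y ⟩
      c * (z * y)  ≡⟨ cong (c *_) (*-inverseˡ y) ⟩
      c * 1ℚ       ≡⟨ *-identityʳ c ⟩
      c            ∎)
    where
    open Relation.Binary.PropositionalEquality.≡-Reasoning
    instance
      y≢0 = pos⇒nonZero y {{positive 0<y}}
    z = 1/ y

  *-monoˡ : ∀ x x′ y → 0ℚ ≤ y → x ≤ x′ → x * y ≤ x′ * y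
  *-monoˡ x x′ y 0≤y = *-monoʳ-≤-nonNeg y {{nonNegative 0≤y}} {x} {x′}

  *-monoʳ : ∀ x y y′ → 0ℚ ≤ x → y ≤ y′ → x * y ≤ x * y′
  *-monoʳ x y y′ 0≤x = *-monoˡ-≤-nonNeg x {{nonNegative 0≤x}} {y} {y′}

  *-monoˡ-< : ∀ x x′ y → 0ℚ < y → x < x′ → x * y < x′ * y
  *-monoˡ-< x x′ y 0<y = *-monoˡ-<-pos y {{positive 0<y}} {x} {x′}

  *-cancelʳ : ∀ x x′ y → 0ℚ ≤ y → x * y < x′ * y → x < x′
  *-cancelʳ x x′ y 0≤y = *-cancelʳ-<-nonNeg y {{nonNegative 0≤y}} {x} {x′}

  pos-left : ∀ x y → 0ℚ ≤ y → 0ℚ < x * y → 0ℚ < x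
  pos-left x y 0≤y 0<xy = *-cancelʳ 0ℚ x y 0≤y (subst (_< x * y) (sym (*-zeroˡ y)) 0<xy)

  raise-left : ∀ x y c → 0ℚ < y → x * y < c → ∃ λ x′ → x < x′ × x′ * y < c
  raise-left x y c 0<y xy<c =
    let z , zy≡c = quotient-exists c y 0<y
        x′ , x<x′ , x′<z =
          <-dense (*-cancelʳ x z y (<⇒≤ 0<y) (subst (x * y <_) (sym zy≡c) xy<c))
    in x′ , x<x′ , subst (x′ * y <_) zy≡c (*-monoˡ-< x′ z y 0<y x′<z)

  lower-left : ∀ x y c → 0ℚ < y → c < x * y → ∃ λ x′ → x′ < x × c < x′ * y
  lower-left x y c 0<y c<xy =
    let z , zy≡c = quotient-exists c y 0<y
        x′ , z<x′ , x′<x =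
          <-dense (*-cancelʳ z x y (<⇒≤ 0<y) (subst (_< x * y) (sym zy≡c) c<xy))
    in x′ , x′<x , subst (_< x′ * y) zy≡c (*-monoˡ-< z x′ y 0<y z<x′)

  x<x+1 : ∀ x → x < x + 1ℚ
  x<x+1 x = subst (_< x + 1ℚ) (+-identityʳ x) (+-monoʳ-< x (positive⁻¹ 1ℚ))

  raise-left₀ : ∀ x y c → 0ℚ ≤ y → x * y < c → ∃ λ x′ → x < x′ × x′ * y < c
  raise-left₀ x y c 0≤y xy<c with <-cmp 0ℚ y
  ... | tri< 0<y _ _ = raise-left x y c 0<y xy<c
  ... | tri≈ _ 0≡y _ = x + 1ℚ , x<x+1 x , subst (_< c) (trans (zero-right x) (sym (zero-right (x + 1ℚ)))) xy<c
    where
    zero-right : ∀ z → z * y ≡ 0ℚ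
    zero-right z = trans (cong (z *_) (sym 0≡y)) (*-zeroʳ z)
  ... | tri> _ _ y<0 = ⊥-elim (<-irrefl refl (<-≤-trans y<0 0≤y))

  raise-both : ∀ x y c → 0ℚ ≤ x → 0ℚ ≤ y → x * y < c →
               ∃ λ x′ → ∃ λ y′ → x < x′ × y < y′ × x′ * y′ < c
  raise-both x y c 0≤x 0≤y xy<c =
    let x′ , x<x′ , x′y<c = raise-left₀ x y c 0≤y xy<c
        y′ , y<y′ , y′x′<c = raise-left y x′ c (≤-<-trans 0≤x x<x′) (subst (_< c) (*-comm x′ y) x′y<c)
    in x′ , y′ , x<x′ , y<y′ , subst (_< c) (*-comm y′ x′) y′x′<c

^-nonNeg : ∀ x k → 0ℚ ≤ x → 0ℚ ≤ x ^ k
^-nonNeg x zero    0≤x = nonNegative⁻¹ 1ℚ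
^-nonNeg x (suc k) 0≤x =
  subst (_≤ x * x ^ k) (*-zeroʳ x) (*-monoʳ x 0ℚ (x ^ k) 0≤x (^-nonNeg x k 0≤x))

^-pos : ∀ x k → 0ℚ < x → 0ℚ < x ^ k
^-pos x zero    0<x = positive⁻¹ 1ℚ
^-pos x (suc k) 0<x =
  subst (_< x * x ^ k) (*-zeroˡ (x ^ k)) (*-monoˡ-< 0ℚ x (x ^ k) (^-pos x k 0<x) 0<x)

^-monoˡ-≤ : ∀ x y k → 0ℚ ≤ x → x ≤ y → x ^ k ≤ y ^ k
^-monoˡ-≤ x y zero    0≤x x≤y = ≤-refl
^-monoˡ-≤ x y (suc k) 0≤x x≤y = ≤-trans
  (*-monoˡ x y (x ^ k) (^-nonNeg x k 0≤x) x≤y)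
  (*-monoʳ y (x ^ k) (y ^ k) (≤-trans 0≤x x≤y) (^-monoˡ-≤ x y k 0≤x x≤y))

^-monoˡ-< : ∀ x y k .{{_ : NonZero k}} → 0ℚ ≤ x → x < y → x ^ k < y ^ k
^-monoˡ-< x y (suc k) 0≤x x<y = ≤-<-trans
  (*-monoʳ x (x ^ k) (y ^ k) 0≤x (^-monoˡ-≤ x y k 0≤x (<⇒≤ x<y)))
  (*-monoˡ-< x y (y ^ k) (^-pos y k (≤-<-trans 0≤x x<y)) x<y)

1≤x^k : ∀ x k → 1ℚ ≤ x → 1ℚ ≤ x ^ k
x≤x^1+k : ∀ x k → 1ℚ ≤ x → x ≤ x ^ suc k

1≤x^k x zero    1≤x = ≤-refl
1≤x^k x (suc k) 1≤x = ≤-trans 1≤x (x≤x^1+k x k 1≤x)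

x≤x^1+k x k 1≤x = subst (_≤ x * x ^ k) (*-identityʳ x)
  (*-monoʳ x 1ℚ (x ^ k) (≤-trans (nonNegative⁻¹ 1ℚ) 1≤x) (1≤x^k x k 1≤x))

^-raise : ∀ q c k → 0ℚ ≤ q → q ^ k < c → ∃ λ r → q < r × r ^ k < c
^-raise q c zero    0≤q 1<c = q + 1ℚ , x<x+1 q , 1<c
^-raise q c (suc k) 0≤q qᵏ⁺¹<c =
  let x , y , q<x , qᵏ<y , xy<c = raise-both q (q ^ k) c 0≤q (^-nonNeg q k 0≤q) qᵏ⁺¹<c
      s , q<s , sᵏ<y = ^-raise q y k 0≤q qᵏ<y
      r = x ⊓ s
      q<r = ⊓-glb-< x s q<x q<s
      0≤r = <⇒≤ (≤-<-trans 0≤q q<r)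
      0≤y = <⇒≤ (≤-<-trans (^-nonNeg q k 0≤q) qᵏ<y)
      rᵏ≤y = ≤-trans (^-monoˡ-≤ r s k 0≤r (p⊓q≤q x s)) (<⇒≤ sᵏ<y)
  in r , q<r ,
     ≤-<-trans (≤-trans (*-monoʳ r (r ^ k) y 0≤r rᵏ≤y) (*-monoˡ r x y 0≤y (p⊓q≤p x s))) xy<c
  where
  ⊓-glb-< : ∀ x s → q < x → q < s → q < x ⊓ s
  ⊓-glb-< x s q<x q<s with ⊓-sel x s
  ... | inj₁ e = subst (q <_) (sym e) q<x
  ... | inj₂ e = subst (q <_) (sym e) q<s

^-lower : ∀ q c k → 0ℚ ≤ c → 0ℚ < q → c < q ^ k → ∃ λ r → 0ℚ < r × r < q × c < r ^ k
^-lower q c zero    0≤c 0<q c<1 = let r , 0<r , r<q = <-dense 0<q in r , 0<r , r<q , c<1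
^-lower q c (suc k) 0≤c 0<q c<qᵏ⁺¹ =
  let x , x<q , c<xqᵏ = lower-left q (q ^ k) c (^-pos q k 0<q) c<qᵏ⁺¹
      0<x = pos-left x (q ^ k) (^-nonNeg q k (<⇒≤ 0<q)) (≤-<-trans 0≤c c<xqᵏ)
      y , y<qᵏ , c<yx = lower-left (q ^ k) x c 0<x (subst (c <_) (*-comm x (q ^ k)) c<xqᵏ)
      0<y = pos-left y x (<⇒≤ 0<x) (≤-<-trans 0≤c c<yx)
      s , 0<s , s<q , y<sᵏ = ^-lower q y k (<⇒≤ 0<y) 0<q y<qᵏ
      r = x ⊔ s
      0<r = <-≤-trans 0<x (p≤p⊔q x s)
      y≤rᵏ = ≤-trans (<⇒≤ y<sᵏ) (^-monoˡ-≤ s r k (<⇒≤ 0<s) (p≤q⊔p x s))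
      xy≤rrᵏ = ≤-trans (*-monoʳ x y (r ^ k) (<⇒≤ 0<x) y≤rᵏ)
                       (*-monoˡ x r (r ^ k) (^-nonNeg r k (<⇒≤ 0<r)) (p≤p⊔q x s))
  in r , 0<r , ⊔-lub-< x s x<q s<q , <-≤-trans (subst (c <_) (*-comm y x) c<yx) xy≤rrᵏ
  where
  ⊔-lub-< : ∀ x s → x < q → s < q → x ⊔ s < q
  ⊔-lub-< x s x<q s<q with ⊔-sel x s
  ... | inj₁ e = subst (_< q) (sym e) x<q
  ... | inj₂ e = subst (_< q) (sym e) s<q

fromℕ : ℕ → ℚ
fromℕ a = + a / 1

0≤fromℕ : ∀ a → 0ℚ ≤ fromℕ a
0≤fromℕ a = nonNegative⁻¹ (fromℕ a) {{normalize-nonNeg a 1}}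

-- The nonnegative real a^(1/k).
root : (a k : ℕ) .{{_ : NonZero k}} → ℝ
root a k@(suc k-1) = record
  { Lower           = Lo
  ; Upper           = Up
  ; lower-inhabited = - 1ℚ , inj₁ (negative⁻¹ (- 1ℚ))
  ; upper-inhabited = fromℕ a + 1ℚ
                    , ≤-<-trans (0≤fromℕ a) (x<x+1 (fromℕ a))
                    , <-≤-trans (x<x+1 (fromℕ a)) (x≤x^1+k _ k-1 1≤a+1)
  ; lower-closed    = closed
  ; upper-closed    = λ {p} {q} p<q (0<p , a<pᵏ) →
                        <-trans 0<p p<q , <-trans a<pᵏ (^-monoˡ-< p q k (<⇒≤ 0<p) p<q)
  ; lower-open      = opened
  ; upper-open      = λ {q} (0<q , a<qᵏ) →
                        let r , 0<r , r<q , a<rᵏ = ^-lower q (fromℕ a) k (0≤fromℕ a) 0<q a<qᵏ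
                        in r , r<q , 0<r , a<rᵏ
  ; disjoint        = λ { (inj₁ q<0) (0<q , _)     → <-asym q<0 0<q
                        ; (inj₂ qᵏ<a) (_ , a<qᵏ) → <-asym qᵏ<a a<qᵏ }
  ; located         = locate
  }
  where
  Lo Up : ℚ → Set
  Lo q = q < 0ℚ ⊎ q ^ k < fromℕ a
  Up q = 0ℚ < q × fromℕ a < q ^ k

  1≤a+1 : 1ℚ ≤ fromℕ a + 1ℚ
  1≤a+1 = subst (_≤ fromℕ a + 1ℚ) (+-identityˡ 1ℚ) (+-monoˡ-≤ 1ℚ (0≤fromℕ a))

  sign : ∀ p → p < 0ℚ ⊎ 0ℚ ≤ p
  sign p with p <? 0ℚ
  ... | yes p<0 = inj₁ p<0
  ... | no  p≮0 = inj₂ (≮⇒≥ p≮0)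

  closed : ∀ {p q} → p < q → Lo q → Lo p
  closed p<q (inj₁ q<0) = inj₁ (<-trans p<q q<0)
  closed {p} {q} p<q (inj₂ qᵏ<a) with sign p
  ... | inj₁ p<0 = inj₁ p<0
  ... | inj₂ 0≤p = inj₂ (<-trans (^-monoˡ-< p q k 0≤p p<q) qᵏ<a)

  opened : ∀ {p} → Lo p → ∃ λ q → p < q × Lo q
  opened {p} l with sign p | l
  ... | inj₁ p<0 | _ = let q , p<q , q<0 = <-dense p<0 in q , p<q , inj₁ q<0
  ... | inj₂ 0≤p | inj₁ p<0 = ⊥-elim (<-irrefl refl (≤-<-trans 0≤p p<0))
  ... | inj₂ 0≤p | inj₂ pᵏ<a = let q , p<q , qᵏ<a = ^-raise p (fromℕ a) k 0≤p pᵏ<a in q , p<q , inj₂ qᵏ<a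

  locate : ∀ {p q} → p < q → Lo p ⊎ Up q
  locate {p} {q} p<q with sign p
  ... | inj₁ p<0 = inj₁ (inj₁ p<0)
  ... | inj₂ 0≤p with p ^ k <? fromℕ a
  ...   | yes pᵏ<a = inj₁ (inj₂ pᵏ<a)
  ...   | no  pᵏ≮a = inj₂ (≤-<-trans 0≤p p<q , ≤-<-trans (≮⇒≥ pᵏ≮a) (^-monoˡ-< p q k 0≤p p<q))

-- Loops are allowed, since identifying vertices can create them.
record Graph (V : Set) : Set₁ where
  infix 4 _~_ _~?_
  field
    _~_   : Rel V 0ℓ
    ~-sym : Symmetric _~_
    _~?_  : Decidable _~_

-- A vertex carrying a loop lies in no independent set: take u = v.
Independent : {V : Set} → Graph V → (V → Bool) → Set
Independent G S = ∀ u v → T (S u) → T (S v) → ¬ (u ~ v)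
  where open Graph G

Vertex : ℕ → ℕ → Set
Vertex r c = Fin r × Fin c

all? : ∀ {r c} {P : Vertex r c → Set} → U.Decidable P → Dec (∀ v → P v)
all? P? = map′ (λ f (i , j) → f i j) (λ f i j → f (i , j))
               (Fin.all? λ i → Fin.all? λ j → P? (i , j))

any? : ∀ {r c} {P : Vertex r c → Set} → U.Decidable P → Dec (∃ P)
any? P? = map′ (λ (i , j , p) → (i , j) , p) (λ ((i , j) , p) → i , j , p)
               (Fin.any? λ i → Fin.any? λ j → P? (i , j))

independent? : ∀ {r c} (G : Graph (Vertex r c)) → U.Decidable (Independent G)
independent? G S = all? λ u → all? λ v → T? (S u) →-dec T? (S v) →-dec ¬? (u ~? v)
  where open Graph G

-- All vectors with entries drawn from a list, each once if the list has no repetitions.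
vectors : {A : Set} → List A → ∀ n → List (Vec A n)
vectors xs zero    = [] ∷ []
vectors xs (suc n) = cartesianProductWith _∷_ xs (vectors xs n)

arrays : ∀ r c → List (Vec (Vec Bool c) r)
arrays r c = vectors (vectors (false ∷ true ∷ []) c) r

support : ∀ {r c} → Vec (Vec Bool c) r → Vertex r c → Bool
support A (i , j) = lookup (lookup A i) j

#independent : ∀ {r c} → Graph (Vertex r c) → ℕ
#independent {r} {c} G = length (filter (λ A → independent? G (support A)) (arrays r c))

-- i(G)^(1/|V(G)|)
rate : ∀ {r c} .{{_ : NonZero r}} .{{_ : NonZero c}} → Graph (Vertex r c) → ℝ
rate {r} {c} G = root (#independent G) (r ℕ.* c) {{ℕ.m*n≢0 r c}}

induced : {V W : Set} → (W → V) → Graph V → Graph W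
induced f G = record
  { _~_   = λ u v → f u ~ f v
  ; ~-sym = ~-sym
  ; _~?_  = λ u v → f u ~? f v
  }
  where open Graph G

-- Identify the vertices of G that have the same image under f.
identify : ∀ {r c} {W : Set} → DecidableEquality W → (Vertex r c → W) →
           Graph (Vertex r c) → Graph W
identify _≟_ f G = record
  { _~_   = λ x y → ∃ λ u → ∃ λ v → f u ≡ x × f v ≡ y × u ~ v
  ; ~-sym = λ (u , v , fu≡x , fv≡y , u~v) → v , u , fv≡y , fu≡x , ~-sym u~v
  ; _~?_  = λ x y → any? λ u → any? λ v → (f u ≟ x) ×-dec (f v ≟ y) ×-dec (u ~? v)
  }
  where open Graph G

Lattice : Set₁
Lattice = Graph (ℕ × ℕ)

-- The r × c block of L whose first row is i₀ and first column is j₀.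
block : Lattice → (i₀ j₀ r c : ℕ) → Graph (Vertex r c)
block L i₀ j₀ r c = induced (λ (i , j) → i₀ ℕ.+ toℕ i , j₀ ℕ.+ toℕ j) L

G : Lattice → (m n : ℕ) → Graph (Vertex (suc m) (suc n))
G L m n = block L 0 0 (suc m) (suc n)

-- On {0,…,n}, reduction modulo n identifies 0 with n and nothing else.
wrap : ∀ n .{{_ : NonZero n}} → Fin (suc n) → Fin n
wrap n j = toℕ j mod n

H : Lattice → (n m : ℕ) .{{_ : NonZero n}} → Graph (Vertex (suc m) n)
H L n m = identify (≡-dec Fin._≟_ Fin._≟_) (λ (i , j) → i , wrap n j) (G L m n)

S : Lattice → (n m : ℕ) .{{_ : NonZero n}} .{{_ : NonZero m}} → Graph (Vertex m n)
S L n m = identify (≡-dec Fin._≟_ Fin._≟_) (λ (i , j) → wrap m i , j) (H L n m)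

-- The index sets are given by their characteristic functions on {0,1}^k; only
-- the entries at members of the index sets are meaningful.
record Matrix (k : ℕ) : Set where
  field
    rowIndex colIndex : Vec Bool k → Bool
    entry             : Vec Bool k → Vec Bool k → ℕ

open Matrix public

infix 4 _≈_

record _≈_ {k} (A B : Matrix k) : Set where
  field
    rowIndex-≗ : rowIndex A ≗ rowIndex B
    colIndex-≗ : colIndex A ≗ colIndex B
    entry-≡    : ∀ α β → T (rowIndex A α) → T (colIndex A β) → entry A α β ≡ entry B α β

SingleIndexSet : ∀ {k} → Matrix k → Set
SingleIndexSet A = rowIndex A ≗ colIndex A

IsSymmetric : ∀ {k} → Matrix k → Set
IsSymmetric A = SingleIndexSet A ×
  (∀ α β → T (rowIndex A α) → T (rowIndex A β) → entry A α β ≡ entry A β α)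

column : ∀ {k} → Vec Bool k → Vertex k 1 → Bool
column α (i , _) = lookup α i

row : ∀ {k} → Vec Bool k → Vertex 1 k → Bool
row α (_ , j) = lookup α j

twoColumns : ∀ {k} → Vec Bool k → Vec Bool k → Vertex k 2 → Bool
twoColumns α β (i , zero)  = lookup α i
twoColumns α β (i , suc _) = lookup β i

twoRows : ∀ {k} → Vec Bool k → Vec Bool k → Vertex 2 k → Bool
twoRows α β (zero  , j) = lookup α j
twoRows α β (suc _ , j) = lookup β j

columnTransfer : Lattice → ∀ m j → Matrix (suc m)
columnTransfer L m j = record
  { rowIndex = λ α → does (independent? (block L 0 j (suc m) 1) (column α))
  ; colIndex = λ β → does (independent? (block L 0 (suc j) (suc m) 1) (column β))
  ; entry    = λ α β → if does (independent? (block L 0 j (suc m) 2) (twoColumns α β))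
                       then 1 else 0
  }

rowTransfer : Lattice → ∀ n i → Matrix (suc n)
rowTransfer L n i = record
  { rowIndex = λ α → does (independent? (block L i 0 1 (suc n)) (row α))
  ; colIndex = λ β → does (independent? (block L (suc i) 0 1 (suc n)) (row β))
  ; entry    = λ α β → if does (independent? (block L i 0 2 (suc n)) (twoRows α β))
                       then 1 else 0
  }

record TransferMultiplicityOne (L : Lattice) : Set where
  open Graph L
  field
    columnLocal  : ∀ {i j i′ j′} → (i , j) ~ (i′ , j′) → ∣ j - j′ ∣ ℕ.≤ 1
    rowLocal     : ∀ {i j i′ j′} → (i , j) ~ (i′ , j′) → ∣ i - i′ ∣ ℕ.≤ 1

    columnMatrix : ∀ m .{{_ : NonZero m}} → Matrix (suc m)
    columnSingle : ∀ m .{{_ : NonZero m}} → SingleIndexSet (columnMatrix m)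
    columnSteps  : ∀ m .{{_ : NonZero m}} j → columnTransfer L m j ≈ columnMatrix m

    rowMatrix    : ∀ n .{{_ : NonZero n}} → Matrix (suc n)
    rowSingle    : ∀ n .{{_ : NonZero n}} → SingleIndexSet (rowMatrix n)
    rowSteps     : ∀ n .{{_ : NonZero n}} i → rowTransfer L n i ≈ rowMatrix n

open TransferMultiplicityOne public

{-# OPTIONS --safe #-}

-- Homogeneity of the transfer matrices makes the compatibility of two sites, and hence
-- the number a(r,c) of independent sets of an r × c block, invariant under translation.
-- Cutting a block shows that a is submultiplicative in both directions; leaving one
-- empty line between two blocks shows that it is supermultiplicative up to that line.
-- So a(k,k)^(1/(k+1)²) bounds the limit from below and a(k,k)^(1/k²) from above, and
-- since (k+1)²/k² → 1 the two families determine a located cut. An independent set of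
-- a block extends by zero to the torus whose sides are longer by one, and the graphs
-- only lose edges from torus to cylinder to plane, so
--   a(m,n) ≤ i(torus) ≤ i(cylinder) ≤ a(m+1,n+1),
-- which forces the same limit for all three.
module Submission where

open import Defs
open import Data.Nat
  using (ℕ; zero; suc; NonZero; _+_; _*_; _≤_; _<_; z≤n; s≤s; ∣_-_∣)
import Data.Nat as ℕ
import Data.Nat.DivMod as ℕ
import Data.Nat.Properties as ℕ
import Data.Nat.Solver as ℕ-Solver
open import Algebra.Bundles using (CommutativeRing)
import Data.Rational.Properties as ℚ
open import Algebra.Properties.Semiring.Exp
  (CommutativeRing.semiring ℚ.+-*-commutativeRing) using (^-assocʳ)
open import Data.Bool using (Bool; true; false; T; if_then_else_; _∨_)
open import Data.Bool.Properties using (T-∨)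
open import Data.Empty using (⊥; ⊥-elim)
open import Data.Fin using (Fin; zero; suc; toℕ; fromℕ<; inject₁; splitAt; _↑ˡ_; _↑ʳ_)
import Data.Fin.Properties as Fin
open import Data.Integer using (+_; -[1+_])
import Data.Integer as ℤ
import Data.Integer.Properties as ℤ
open import Data.List using (List; []; _∷_; length; filter; cartesianProduct; map)
import Data.List as List
import Data.List.Properties as List
open import Data.List.Membership.Propositional using (_∈_)
open import Data.List.Membership.Propositional.Properties
  using (∈-lookup; ∈-filter⁺; ∈-filter⁻; ∈-cartesianProductWith⁺; ∈-cartesianProduct⁺; ∈-cartesianProduct⁻)
import Data.List.Membership.Setoid.Properties as SetoidMembership
import Data.List.Relation.Unary.All as All
open import Data.List.Relation.Unary.All using ([]; _∷_)
open import Data.List.Relation.Unary.AllPairs using ([]; _∷_)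
import Data.List.Relation.Unary.Any as Any
open import Data.List.Relation.Unary.Any using (here; there)
open import Data.List.Relation.Unary.Unique.Propositional using (Unique)
import Data.List.Relation.Unary.Unique.Propositional.Properties as Unique
open import Data.Maybe using (Maybe; just; nothing)
import Data.Maybe as Maybe
open import Data.Product using (Σ; ∃; _×_; _,_; proj₁; proj₂; swap)
open import Data.Rational using (mkℚ; 0ℚ; 1ℚ; ½; toℚᵘ; ↥_)
import Data.Rational as ℚ
import Data.Rational.Solver as ℚ-Solver
open import Data.Rational.Unnormalised using (mkℚᵘ; *≤*; *<*; *≡*)
import Data.Rational.Unnormalised as ℚᵘ
import Data.Rational.Unnormalised.Properties as ℚᵘ
open import Data.Sum using (_⊎_; inj₁; inj₂; [_,_])
import Data.Sum as Sum
open import Data.Unit using (tt)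
open import Data.Vec using (Vec; []; _∷_; lookup; tabulate)
import Data.Vec.Properties as Vec
open import Function using (_∘_; id; Equivalence)
open import Relation.Binary.PropositionalEquality
  using (_≡_; _≗_; refl; sym; trans; cong; cong₂; subst; subst₂; setoid)
open import Relation.Nullary using (Dec; yes; no; does; ¬_; contradiction)

-- Rational powers

toℚᵘ-fromℕ : ∀ a → toℚᵘ (fromℕ a) ℚᵘ.≃ mkℚᵘ (+ a) 0
toℚᵘ-fromℕ a = ℚ.toℚᵘ-fromℚᵘ (mkℚᵘ (+ a) 0)

fromℕ-homo-+ : ∀ a b → fromℕ (a + b) ≡ fromℕ a ℚ.+ fromℕ b
fromℕ-homo-+ a b = ℚ.toℚᵘ-injective (begin-equality
  toℚᵘ (fromℕ (a + b))                  ≃⟨ toℚᵘ-fromℕ (a + b) ⟩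
  mkℚᵘ (+ (a + b)) 0                    ≃⟨ *≡* (cong (ℤ._* + 1) (cong₂ ℤ._+_ (sym (ℤ.*-identityʳ (+ a))) (sym (ℤ.*-identityʳ (+ b))))) ⟩
  mkℚᵘ (+ a) 0 ℚᵘ.+ mkℚᵘ (+ b) 0        ≃⟨ ℚᵘ.+-cong (toℚᵘ-fromℕ a) (toℚᵘ-fromℕ b) ⟨
  toℚᵘ (fromℕ a) ℚᵘ.+ toℚᵘ (fromℕ b)    ≃⟨ ℚ.toℚᵘ-homo-+ (fromℕ a) (fromℕ b) ⟨
  toℚᵘ (fromℕ a ℚ.+ fromℕ b)            ∎)
  where open ℚᵘ.≤-Reasoning

fromℕ-homo-* : ∀ a b → fromℕ (a * b) ≡ fromℕ a ℚ.* fromℕ b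
fromℕ-homo-* a b = ℚ.toℚᵘ-injective (begin-equality
  toℚᵘ (fromℕ (a * b))                  ≃⟨ toℚᵘ-fromℕ (a * b) ⟩
  mkℚᵘ (+ (a * b)) 0                    ≃⟨ *≡* (cong (ℤ._* + 1) (ℤ.pos-* a b)) ⟩
  mkℚᵘ (+ a) 0 ℚᵘ.* mkℚᵘ (+ b) 0        ≃⟨ ℚᵘ.*-cong (toℚᵘ-fromℕ a) (toℚᵘ-fromℕ b) ⟨
  toℚᵘ (fromℕ a) ℚᵘ.* toℚᵘ (fromℕ b)    ≃⟨ ℚ.toℚᵘ-homo-* (fromℕ a) (fromℕ b) ⟨
  toℚᵘ (fromℕ a ℚ.* fromℕ b)            ∎)
  where open ℚᵘ.≤-Reasoning

fromℕ-mono-≤ : ∀ {a b} → a ≤ b → fromℕ a ℚ.≤ fromℕ b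
fromℕ-mono-≤ {a} {b} a≤b = ℚ.toℚᵘ-cancel-≤ (begin
  toℚᵘ (fromℕ a)  ≃⟨ toℚᵘ-fromℕ a ⟩
  mkℚᵘ (+ a) 0    ≤⟨ *≤* (ℤ.*-monoʳ-≤-nonNeg (+ 1) (ℤ.+≤+ a≤b)) ⟩
  mkℚᵘ (+ b) 0    ≃⟨ toℚᵘ-fromℕ b ⟨
  toℚᵘ (fromℕ b)  ∎)
  where open ℚᵘ.≤-Reasoning

fromℕ-homo-^ : ∀ a k → fromℕ (a ℕ.^ k) ≡ fromℕ a ^ k
fromℕ-homo-^ a zero    = refl
fromℕ-homo-^ a (suc k) = trans (fromℕ-homo-* a (a ℕ.^ k)) (cong (fromℕ a ℚ.*_) (fromℕ-homo-^ a k))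

-- The denominator is at least 1, so no rational exceeds the absolute value of its numerator.
<fromℕ : ∀ x → x ℚ.< fromℕ (suc ℤ.∣ ↥ x ∣)
<fromℕ x@(mkℚ n d-1 _) = ℚ.toℚᵘ-cancel-< (begin-strict
  mkℚᵘ n d-1                  <⟨ *<* (bound n) ⟩
  mkℚᵘ (+ suc ℤ.∣ n ∣) 0        ≃⟨ toℚᵘ-fromℕ (suc ℤ.∣ n ∣) ⟨
  toℚᵘ (fromℕ (suc ℤ.∣ n ∣))    ∎)
  where
  open ℚᵘ.≤-Reasoning
  bound : ∀ n → n ℤ.* + 1 ℤ.< + suc ℤ.∣ n ∣ ℤ.* + suc d-1
  bound (+ a)    = subst (ℤ._< + suc a ℤ.* + suc d-1) (sym (ℤ.*-identityʳ (+ a)))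
                     (ℤ.+<+ (ℕ.m≤m*n (suc a) (suc d-1)))
  bound -[1+ a ] = ℤ.-<+

archimedean : ∀ c d → 0ℚ ℚ.< d → ∃ λ n → c ℚ.< fromℕ n ℚ.* d
archimedean c d 0<d = suc ℤ.∣ ↥ x ∣ , subst (ℚ._< fromℕ (suc ℤ.∣ ↥ x ∣) ℚ.* d) xd≡c
                        (ℚ.*-monoˡ-<-pos d {{ℚ.positive 0<d}} (<fromℕ x))
  where
  instance
    d≢0 = ℚ.pos⇒nonZero d {{ℚ.positive 0<d}}
  x = c ℚ.* ℚ.1/ d
  xd≡c : x ℚ.* d ≡ c
  xd≡c = trans (ℚ.*-assoc c (ℚ.1/ d) d) (trans (cong (c ℚ.*_) (ℚ.*-inverseˡ d)) (ℚ.*-identityʳ c))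

0≤1 : 0ℚ ℚ.≤ 1ℚ
0≤1 = ℚ.nonNegative⁻¹ 1ℚ

0<1 : 0ℚ ℚ.< 1ℚ
0<1 = ℚ.positive⁻¹ 1ℚ

*-mono-≤ : ∀ {x x′ y y′} → 0ℚ ℚ.≤ x → 0ℚ ℚ.≤ y → x ℚ.≤ x′ → y ℚ.≤ y′ → x ℚ.* y ℚ.≤ x′ ℚ.* y′
*-mono-≤ {x} {x′} {y} {y′} 0≤x 0≤y x≤x′ y≤y′ = ℚ.≤-trans
  (ℚ.*-monoʳ-≤-nonNeg y {{ℚ.nonNegative 0≤y}} x≤x′)
  (ℚ.*-monoˡ-≤-nonNeg x′ {{ℚ.nonNegative (ℚ.≤-trans 0≤x x≤x′)}} y≤y′)

^-monoʳ-≤ : ∀ {x j k} → 1ℚ ℚ.≤ x → j ≤ k → x ^ j ℚ.≤ x ^ k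
^-monoʳ-≤ {x} {k = k} 1≤x z≤n = 1≤x^k x k 1≤x
^-monoʳ-≤ {x} 1≤x (s≤s j≤k) =
  ℚ.*-monoˡ-≤-nonNeg x {{ℚ.nonNegative (ℚ.≤-trans 0≤1 1≤x)}} (^-monoʳ-≤ 1≤x j≤k)

1^ : ∀ k → 1ℚ ^ k ≡ 1ℚ
1^ zero    = refl
1^ (suc k) = trans (ℚ.*-identityˡ (1ℚ ^ k)) (1^ k)

^-comm : ∀ x j k → (x ^ j) ^ k ≡ (x ^ k) ^ j
^-comm x j k = trans (^-assocʳ x j k) (trans (cong (x ^_) (ℕ.*-comm j k)) (sym (^-assocʳ x k j)))

^-cancel-< : ∀ x y k → 0ℚ ℚ.≤ y → x ^ k ℚ.< y ^ k → x ℚ.< y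
^-cancel-< x y k 0≤y xᵏ<yᵏ with x ℚ.<? y
... | yes x<y = x<y
... | no  x≮y = ⊥-elim (ℚ.<-irrefl refl (ℚ.<-≤-trans xᵏ<yᵏ (^-monoˡ-≤ y x k 0≤y (ℚ.≮⇒≥ x≮y))))

-- A form of Bernoulli's inequality (1 + d/P)^n ≥ 1 + n (d/P), cleared of denominators.
bernoulli : ∀ P d n → 0ℚ ℚ.≤ P → 0ℚ ℚ.≤ d →
            P ^ n ℚ.* (P ℚ.+ fromℕ n ℚ.* d) ℚ.≤ P ℚ.* (P ℚ.+ d) ^ n
bernoulli P d zero    0≤P 0≤d = ℚ.≤-reflexive
  (solve 2 (λ P d → con 1ℚ :* (P :+ con 0ℚ :* d) := P :* con 1ℚ) refl P d)
  where open ℚ-Solver.+-*-Solver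
bernoulli P d (suc n) 0≤P 0≤d = begin
  P ℚ.* P ^ n ℚ.* (P ℚ.+ fromℕ (suc n) ℚ.* d)
    ≡⟨ cong (λ x → P ℚ.* P ^ n ℚ.* (P ℚ.+ x ℚ.* d)) (fromℕ-homo-+ 1 n) ⟩
  P ℚ.* P ^ n ℚ.* (P ℚ.+ (1ℚ ℚ.+ N) ℚ.* d)
    ≡⟨ ℚ.+-identityʳ _ ⟨
  P ℚ.* P ^ n ℚ.* (P ℚ.+ (1ℚ ℚ.+ N) ℚ.* d) ℚ.+ 0ℚ
    -- The added term is exactly what (P + d) Pⁿ (P + n d) has beyond the left-hand side, so the
    -- next line factors.
    ≤⟨ ℚ.+-monoʳ-≤ (P ℚ.* P ^ n ℚ.* (P ℚ.+ (1ℚ ℚ.+ N) ℚ.* d)) 0≤rest ⟩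
  P ℚ.* P ^ n ℚ.* (P ℚ.+ (1ℚ ℚ.+ N) ℚ.* d) ℚ.+ N ℚ.* (d ℚ.* d) ℚ.* P ^ n
    ≡⟨ solve 4 (λ P Q N d → P :* Q :* (P :+ (con 1ℚ :+ N) :* d) :+ N :* (d :* d) :* Q
                         := (P :+ d) :* (Q :* (P :+ N :* d))) refl P (P ^ n) N d ⟩
  (P ℚ.+ d) ℚ.* (P ^ n ℚ.* (P ℚ.+ N ℚ.* d))
    ≤⟨ ℚ.*-monoˡ-≤-nonNeg (P ℚ.+ d) {{ℚ.nonNegative 0≤P+d}} (bernoulli P d n 0≤P 0≤d) ⟩
  (P ℚ.+ d) ℚ.* (P ℚ.* (P ℚ.+ d) ^ n)
    ≡⟨ solve 3 (λ P R Q → R :* (P :* Q) := P :* (R :* Q)) refl P (P ℚ.+ d) ((P ℚ.+ d) ^ n) ⟩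
  P ℚ.* (P ℚ.+ d) ^ suc n ∎
  where
  open ℚ.≤-Reasoning
  open ℚ-Solver.+-*-Solver
  N = fromℕ n
  0≤P+d : 0ℚ ℚ.≤ P ℚ.+ d
  0≤P+d = ℚ.+-mono-≤ 0≤P 0≤d
  0≤* : ∀ {x y} → 0ℚ ℚ.≤ x → 0ℚ ℚ.≤ y → 0ℚ ℚ.≤ x ℚ.* y
  0≤* = *-mono-≤ {0ℚ} {_} {0ℚ} ℚ.≤-refl ℚ.≤-refl
  0≤rest : 0ℚ ℚ.≤ N ℚ.* (d ℚ.* d) ℚ.* P ^ n
  0≤rest = 0≤* (0≤* (0≤fromℕ n) (0≤* 0≤d 0≤d)) (^-nonNeg P n 0≤P)

x+[y-x]≡y : ∀ P Q → P ℚ.+ (Q ℚ.- P) ≡ Q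
x+[y-x]≡y = solve 2 (λ P Q → P :+ (Q :- P) := Q) refl
  where open ℚ-Solver.+-*-Solver

x<y⇒0<y-x : ∀ {P Q} → P ℚ.< Q → 0ℚ ℚ.< Q ℚ.- P
x<y⇒0<y-x {P} {Q} P<Q = subst (ℚ._< Q ℚ.- P) (ℚ.+-inverseʳ P) (ℚ.+-monoˡ-< (ℚ.- P) P<Q)

-- With d = Q - P, Bernoulli gives (Q/P)ⁿ ≥ 1 + n d/P, which exceeds P once n d > P². A strict gap
-- between the bases thus eventually absorbs one extra factor P.
power-gap₁ : ∀ {P Q} → 1ℚ ℚ.≤ P → P ℚ.< Q → ∃ λ N → ∀ n → N ≤ n → P ^ suc n ℚ.< Q ^ n
power-gap₁ {P} {Q} 1≤P P<Q = N , λ n N≤n → propagate (ℕ.≤⇒≤′ N≤n)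
  where
  d   = Q ℚ.- P
  0≤d = ℚ.<⇒≤ (x<y⇒0<y-x P<Q)
  0<P = ℚ.<-≤-trans 0<1 1≤P
  0≤P = ℚ.<⇒≤ 0<P
  N   = proj₁ (archimedean (P ℚ.* P) d (x<y⇒0<y-x P<Q))
  PP< : P ℚ.* P ℚ.< P ℚ.+ fromℕ N ℚ.* d
  PP< = ℚ.<-≤-trans (proj₂ (archimedean (P ℚ.* P) d (x<y⇒0<y-x P<Q)))
          (subst (ℚ._≤ P ℚ.+ fromℕ N ℚ.* d) (ℚ.+-identityˡ _) (ℚ.+-monoˡ-≤ _ 0≤P))
  start : P ^ suc N ℚ.< Q ^ N
  start = ℚ.*-cancelˡ-<-nonNeg P {{ℚ.nonNegative 0≤P}} (begin-strict
    P ℚ.* (P ℚ.* P ^ N)                 ≡⟨ trans (sym (ℚ.*-assoc P P (P ^ N))) (ℚ.*-comm (P ℚ.* P) (P ^ N)) ⟩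
    P ^ N ℚ.* (P ℚ.* P)                 <⟨ ℚ.*-monoʳ-<-pos (P ^ N) {{ℚ.positive (^-pos P N 0<P)}} PP< ⟩
    P ^ N ℚ.* (P ℚ.+ fromℕ N ℚ.* d)     ≤⟨ bernoulli P d N 0≤P 0≤d ⟩
    P ℚ.* (P ℚ.+ d) ^ N                 ≡⟨ cong (λ x → P ℚ.* x ^ N) (x+[y-x]≡y P Q) ⟩
    P ℚ.* Q ^ N                         ∎)
    where open ℚ.≤-Reasoning
  propagate : ∀ {n} → N ℕ.≤′ n → P ^ suc n ℚ.< Q ^ n
  propagate ℕ.≤′-refl = start
  propagate (ℕ.≤′-step {n} N≤n) = ℚ.<-≤-trans
    (ℚ.*-monoʳ-<-pos P {{ℚ.positive 0<P}} (propagate N≤n))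
    (ℚ.*-monoʳ-≤-nonNeg (Q ^ n) {{ℚ.nonNegative (^-nonNeg Q n (ℚ.<⇒≤ (ℚ.<-trans 0<P P<Q)))}} (ℚ.<⇒≤ P<Q))

-- Choose R between P and Q; the gap P < R pays for the extra unit in u and the gap R < Q for the
-- one in w. The bound is uniform in u and w separately, as a double limit demands, and makes
-- rounding to whole tiles harmless.
power-gap : ∀ {P Q} → 1ℚ ℚ.≤ P → P ℚ.< Q →
            ∃ λ N → ∀ u w → N ≤ u → N ≤ w → P ^ (suc u * suc w) ℚ.< Q ^ (u * w)
power-gap {P} {Q} 1≤P P<Q =
  let R , P<R , R<Q = ℚ.<-dense P<Q
      1≤R = ℚ.≤-trans 1≤P (ℚ.<⇒≤ P<R)
      M , gapM = power-gap₁ 1≤P P<R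
      N , gapN = power-gap₁ 1≤R R<Q
      0≤P = ℚ.≤-trans 0≤1 1≤P
      0≤R = ℚ.≤-trans 0≤1 1≤R
  in M ℕ.⊔ N , λ u w u≥ w≥ → begin-strict
    P ^ (suc u * suc w)   ≡⟨ ^-assocʳ P (suc u) (suc w) ⟨
    (P ^ suc u) ^ suc w   <⟨ ^-monoˡ-< (P ^ suc u) (R ^ u) (suc w) (^-nonNeg P (suc u) 0≤P)
                               (gapM u (ℕ.≤-trans (ℕ.m≤m⊔n M N) u≥)) ⟩
    (R ^ u) ^ suc w       ≡⟨ ^-comm R u (suc w) ⟩
    (R ^ suc w) ^ u       ≤⟨ ^-monoˡ-≤ (R ^ suc w) (Q ^ w) u (^-nonNeg R (suc w) 0≤R)
                               (ℚ.<⇒≤ (gapN w (ℕ.≤-trans (ℕ.m≤n⊔m M N) w≥))) ⟩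
    (Q ^ w) ^ u           ≡⟨ ^-comm Q w u ⟩
    (Q ^ u) ^ w           ≡⟨ ^-assocʳ Q u w ⟩
    Q ^ (u * w)           ∎
  where open ℚ.≤-Reasoning

-- Walk upwards from a lower bound in steps of δ = ε/2. If `located` places p + δ below x, the walk
-- continues from there; if it places p + 2δ above x, then p is the answer. The Archimedean property
-- bounds the number of steps, since running out of them would put p on both sides of the cut.
cauchy : ∀ (x : ℝ) ε → 0ℚ ℚ.< ε → ∃ λ p → Lower x p × Upper x (p ℚ.+ ε)
cauchy x ε 0<ε =
  let a , a<x = lower-inhabited x
      b , x<b = upper-inhabited x
      n , b-a< = archimedean (b ℚ.- a) δ 0<δ
      b<a+nδ = subst (ℚ._< a ℚ.+ fromℕ n ℚ.* δ) (x+[y-x]≡y a b) (ℚ.+-monoʳ-< a b-a<)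
  in search n a a<x (upper-closed x b<a+nδ x<b)
  where
  open ℚ-Solver.+-*-Solver
  δ = ½ ℚ.* ε
  0<δ : 0ℚ ℚ.< δ
  0<δ = subst (ℚ._< δ) (ℚ.*-zeroʳ ½) (ℚ.*-monoʳ-<-pos ½ 0<ε)
  p+δ+δ : ∀ p → p ℚ.+ δ ℚ.+ δ ≡ p ℚ.+ ε
  p+δ+δ p = solve 2 (λ p e → p :+ con ½ :* e :+ con ½ :* e := p :+ e) refl p ε
  search : ∀ n p → Lower x p → Upper x (p ℚ.+ fromℕ n ℚ.* δ) → ∃ λ p → Lower x p × Upper x (p ℚ.+ ε)
  search zero p p<x x<p = ⊥-elim (disjoint x p<x
    (subst (Upper x) (solve 2 (λ p d → p :+ con 0ℚ :* d := p) refl p δ) x<p))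
  search (suc n) p p<x x<p+ with located x {p ℚ.+ δ} {p ℚ.+ δ ℚ.+ δ}
                                   (subst (ℚ._< p ℚ.+ δ ℚ.+ δ) (ℚ.+-identityʳ (p ℚ.+ δ)) (ℚ.+-monoʳ-< (p ℚ.+ δ) 0<δ))
  ... | inj₂ x<p+2δ = p , p<x , subst (Upper x) (p+δ+δ p) x<p+2δ
  ... | inj₁ p+δ<x  = search n (p ℚ.+ δ) p+δ<x (subst (Upper x)
          (trans (cong (λ k → p ℚ.+ k ℚ.* δ) (fromℕ-homo-+ 1 n))
                 (solve 3 (λ p k d → p :+ (con 1ℚ :+ k) :* d := p :+ d :+ k :* d) refl p (fromℕ n) δ))
          x<p+)

-- The limit of a grid count

-- The two-dimensional counterpart of a sequence that is submultiplicative, and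
-- supermultiplicative up to a separating line.
record IsGridCount (a : ℕ → ℕ → ℕ) : Set where
  field
    positive : ∀ r c → 1 ≤ a r c
    monotone : ∀ {r r′ c c′} → r ≤ r′ → c ≤ c′ → a r c ≤ a r′ c′
    tile-≤   : ∀ r c k l → a (k * r) (l * c) ≤ a r c ℕ.^ (k * l)
    tile-≥   : ∀ r c k l → a r c ℕ.^ (k * l) ≤ a (k * suc r) (l * suc c)

-- Here u is the integer quotient of s by K: side s contains u tiles of side K, and even side s + 1
-- is covered by u + 1 of them.
quotient-bounds : ∀ K N s .{{_ : NonZero K}} → N * K ≤ s →
                  ∃ λ u → N ≤ u × u * K ≤ s × suc s ≤ suc u * K
quotient-bounds K N s NK≤s = u , N≤u , ℕ.m/n*n≤m s K , s<
  where
  u = s ℕ./ K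
  N≤u = subst (_≤ u) (ℕ.m*n/n≡m N K) (ℕ./-monoˡ-≤ K NK≤s)
  s< : s < suc u * K
  s< = subst (_< suc u * K) (sym (ℕ.m≡m%n+[m/n]*n s K)) (ℕ.+-monoˡ-< (u * K) (ℕ.m%n<n s K))

^-block : ∀ x K u w → x ^ ((u * K) * (w * K)) ≡ (x ^ (K * K)) ^ (u * w)
^-block x K u w = trans (cong (x ^_) (solve 3 (λ K u w → (u :* K) :* (w :* K) := (K :* K) :* (u :* w)) refl K u w))
                        (sym (^-assocʳ x (K * K) (u * w)))
  where open ℕ-Solver.+-*-Solver

module GridLimit {a : ℕ → ℕ → ℕ} (count : IsGridCount a) where
  open IsGridCount count

  1≤ : ∀ r c → 1ℚ ℚ.≤ fromℕ (a r c)
  1≤ r c = fromℕ-mono-≤ (positive r c)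

  tile-≤ℚ : ∀ r c k l → fromℕ (a (k * r) (l * c)) ℚ.≤ fromℕ (a r c) ^ (k * l)
  tile-≤ℚ r c k l = subst (fromℕ (a (k * r) (l * c)) ℚ.≤_) (fromℕ-homo-^ (a r c) (k * l))
                      (fromℕ-mono-≤ (tile-≤ r c k l))

  tile-≥ℚ : ∀ r c k l → fromℕ (a r c) ^ (k * l) ℚ.≤ fromℕ (a (k * suc r) (l * suc c))
  tile-≥ℚ r c k l = subst (ℚ._≤ fromℕ (a (k * suc r) (l * suc c))) (fromℕ-homo-^ (a r c) (k * l))
                      (fromℕ-mono-≤ (tile-≥ r c k l))

  -- In `below` each tile is charged for its separating line, hence the degree (k + 1)² for side k.
  -- In `above` the side is itself k + 1, which keeps the degree nonzero.
  below above : ℕ → ℝ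
  below k = root (a k k) (suc k * suc k)
  above k = root (a (suc k) (suc k)) (suc k * suc k)

  -- Count the square of side K j in two ways, where K = k + 1: it holds j² tiles of side k with
  -- their separating lines, and it is cut into K² tiles of side j. Comparing both with q to the
  -- power K² j² gives a contradiction.
  below-above-disjoint : ∀ {q} k j → Lower (below k) q → Upper (above j) q → ⊥
  below-above-disjoint k j (inj₁ q<0) (0<q , _) = ℚ.<-asym q<0 0<q
  below-above-disjoint {q} k j′ (inj₂ qᴷᴷ<a) (0<q , a<qʲʲ) = ℚ.<-irrefl refl (begin-strict
    (q ^ (K * K)) ^ (j * j)        <⟨ ^-monoˡ-< (q ^ (K * K)) (fromℕ (a k k)) (j * j) (^-nonNeg q (K * K) 0≤q) qᴷᴷ<a ⟩
    fromℕ (a k k) ^ (j * j)        ≤⟨ tile-≥ℚ k k j j ⟩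
    fromℕ (a (j * K) (j * K))      ≡⟨ cong₂ (λ x y → fromℕ (a x y)) (ℕ.*-comm j K) (ℕ.*-comm j K) ⟩
    fromℕ (a (K * j) (K * j))      ≤⟨ tile-≤ℚ j j K K ⟩
    fromℕ (a j j) ^ (K * K)        <⟨ ^-monoˡ-< (fromℕ (a j j)) (q ^ (j * j)) (K * K) (0≤fromℕ (a j j)) a<qʲʲ ⟩
    (q ^ (j * j)) ^ (K * K)        ≡⟨ ^-comm q (j * j) (K * K) ⟩
    (q ^ (K * K)) ^ (j * j)        ∎)
    where
    open ℚ.≤-Reasoning
    K = suc k
    j = suc j′
    0≤q = ℚ.<⇒≤ 0<q

  -- For p < 1 the bound 1 ≤ a(0,0) suffices. Otherwise compare a(N+1,N+1) with p to the power
  -- (N+2)²: if the power is smaller, p lies below; if not, the count is less than q to the power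
  -- (N+1)² by `power-gap`, and q lies above.
  below-above-located : ∀ {p q} → p ℚ.< q → (∃ λ k → Lower (below k) p) ⊎ (∃ λ k → Upper (above k) q)
  below-above-located {p} {q} p<q with p ℚ.<? 1ℚ
  ... | yes p<1 = inj₁ (0 , inj₂ (ℚ.<-≤-trans (subst (ℚ._< 1ℚ) (sym (ℚ.*-identityʳ p)) p<1) (1≤ 0 0)))
  ... | no  p≮1 with power-gap (ℚ.≮⇒≥ p≮1) p<q
  ...   | N , gap with p ^ (suc (suc N) * suc (suc N)) ℚ.<? fromℕ (a (suc N) (suc N))
  ...     | yes p< = inj₁ (suc N , inj₂ p<)
  ...     | no  p≮ = inj₂ (N , ℚ.<-trans (ℚ.<-≤-trans 0<1 (ℚ.≮⇒≥ p≮1)) p<q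
                             , ℚ.≤-<-trans (ℚ.≮⇒≥ p≮) (gap (suc N) (suc N) (ℕ.n≤1+n N) (ℕ.n≤1+n N)))

  -- The cut is at once the supremum of the family `below` and the infimum of the family `above`.
  limit : ℝ
  limit = record
    { Lower           = λ q → ∃ λ k → Lower (below k) q
    ; Upper           = λ q → ∃ λ k → Upper (above k) q
    ; lower-inhabited = let p , l = lower-inhabited (below 0) in p , 0 , l
    ; upper-inhabited = let q , u = upper-inhabited (above 0) in q , 0 , u
    ; lower-closed    = λ p<q (k , l) → k , lower-closed (below k) p<q l
    ; upper-closed    = λ p<q (k , u) → k , upper-closed (above k) p<q u
    ; lower-open      = λ (k , l) → let q , p<q , l′ = lower-open (below k) l in q , p<q , k , l′
    ; upper-open      = λ (k , u) → let p , p<q , u′ = upper-open (above k) u in p , p<q , k , u′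
    ; disjoint        = λ (k , l) (j , u) → below-above-disjoint k j l u
    ; located         = below-above-located
    }

  -- Openness gives p′ > p still below some a(k,k)^(1/K²) with K = k + 1. An s × t block holds u w
  -- such tiles with their separating lines, and the gap between p and p′ pays for the part lost to
  -- rounding.
  eventually-Lower : ∀ {p} → Lower limit p →
    ∃ λ N → ∀ s t v → N ≤ s → N ≤ t → a s t ≤ v → Lower (root v (suc s * suc t)) p
  eventually-Lower {p} l with p ℚ.<? 0ℚ | p ℚ.<? 1ℚ
  ... | yes p<0 | _       = 0 , λ s t v _ _ _ → inj₁ p<0
  -- `power-gap` asks for a base of at least 1. Below 1, positive powers stay below 1, and every
  -- count is at least 1.
  ... | no  p≮0 | yes p<1 = 0 , λ s t v _ _ a≤v → inj₂ (begin-strict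
    p ^ (suc s * suc t)     <⟨ ^-monoˡ-< p 1ℚ (suc s * suc t) (ℚ.≮⇒≥ p≮0) p<1 ⟩
    1ℚ ^ (suc s * suc t)    ≡⟨ 1^ (suc s * suc t) ⟩
    1ℚ                      ≤⟨ 1≤ s t ⟩
    fromℕ (a s t)           ≤⟨ fromℕ-mono-≤ a≤v ⟩
    fromℕ v                 ∎)
    where open ℚ.≤-Reasoning
  ... | no  _   | no  p≮1 with lower-open limit l
  ...   | p′ , p<p′ , k , inj₁ p′<0 = ⊥-elim (p≮1 (ℚ.<-trans p<p′ (ℚ.<-trans p′<0 0<1)))
  ...   | p′ , p<p′ , k , inj₂ p′ᴷᴷ<a =
    proj₁ gap * K , λ s t v s≥ t≥ a≤v →
      let u , N≤u , uK≤s , s<uK = quotient-bounds K (proj₁ gap) s s≥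
          w , N≤w , wK≤t , t<wK = quotient-bounds K (proj₁ gap) t t≥
      in inj₂ (begin-strict
        p ^ (suc s * suc t)                   ≤⟨ ^-monoʳ-≤ 1≤p (ℕ.*-mono-≤ s<uK t<wK) ⟩
        p ^ ((suc u * K) * (suc w * K))       ≡⟨ ^-block p K (suc u) (suc w) ⟩
        (p ^ (K * K)) ^ (suc u * suc w)       <⟨ proj₂ gap u w N≤u N≤w ⟩
        (p′ ^ (K * K)) ^ (u * w)              ≤⟨ ^-monoˡ-≤ (p′ ^ (K * K)) (fromℕ (a k k)) (u * w) (^-nonNeg p′ (K * K) 0≤p′) (ℚ.<⇒≤ p′ᴷᴷ<a) ⟩
        fromℕ (a k k) ^ (u * w)               ≤⟨ tile-≥ℚ k k u w ⟩
        fromℕ (a (u * K) (w * K))             ≤⟨ fromℕ-mono-≤ (ℕ.≤-trans (monotone uK≤s wK≤t) a≤v) ⟩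
        fromℕ v                               ∎)
    where
    open ℚ.≤-Reasoning
    K = suc k
    1≤p = ℚ.≮⇒≥ p≮1
    0≤p = ℚ.≤-trans 0≤1 1≤p
    0≤p′ = ℚ.≤-trans 0≤p (ℚ.<⇒≤ p<p′)
    gap = power-gap (1≤x^k p (K * K) 1≤p) (^-monoˡ-< p p′ (K * K) 0≤p p<p′)

  -- Dual to the lower bound: the block of sides s + 1 and t + 1 is covered by (u + 1)(w + 1) tiles
  -- of side K, and the gap between q′ and q pays for the excess.
  eventually-Upper : ∀ {q} → Upper limit q →
    ∃ λ N → ∀ s t v → N ≤ s → N ≤ t → v ≤ a (suc s) (suc t) → Upper (root v (suc s * suc t)) q
  eventually-Upper {q} h =
    let q′ , q′<q , k , 0<q′ , a<q′ᴷᴷ = upper-open limit h in from q′ k q′<q 0<q′ a<q′ᴷᴷ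
   where
   from : ∀ q′ k → q′ ℚ.< q → 0ℚ ℚ.< q′ → fromℕ (a (suc k) (suc k)) ℚ.< q′ ^ (suc k * suc k) →
     ∃ λ N → ∀ s t v → N ≤ s → N ≤ t → v ≤ a (suc s) (suc t) → Upper (root v (suc s * suc t)) q
   from q′ k q′<q 0<q′ a<q′ᴷᴷ =
    proj₁ gap * K , λ s t v s≥ t≥ v≤a →
      let u , N≤u , uK≤s , s<uK = quotient-bounds K (proj₁ gap) s s≥
          w , N≤w , wK≤t , t<wK = quotient-bounds K (proj₁ gap) t t≥
      in 0<q , (begin-strict
        fromℕ v                                ≤⟨ fromℕ-mono-≤ (ℕ.≤-trans v≤a (monotone s<uK t<wK)) ⟩
        fromℕ (a (suc u * K) (suc w * K))      ≤⟨ tile-≤ℚ K K (suc u) (suc w) ⟩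
        fromℕ (a K K) ^ (suc u * suc w)        ≤⟨ ^-monoˡ-≤ (fromℕ (a K K)) (q′ ^ (K * K)) (suc u * suc w) (0≤fromℕ (a K K)) (ℚ.<⇒≤ a<q′ᴷᴷ) ⟩
        (q′ ^ (K * K)) ^ (suc u * suc w)       <⟨ proj₂ gap u w N≤u N≤w ⟩
        (q ^ (K * K)) ^ (u * w)                ≡⟨ ^-block q K u w ⟨
        q ^ ((u * K) * (w * K))                ≤⟨ ^-monoʳ-≤ 1≤q (ℕ.*-mono-≤ (ℕ.m≤n⇒m≤1+n uK≤s) (ℕ.m≤n⇒m≤1+n wK≤t)) ⟩
        q ^ (suc s * suc t)                    ∎)
    where
    open ℚ.≤-Reasoning
    K = suc k
    0<q = ℚ.<-trans 0<q′ q′<q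
    -- Counts are at least 1, which forces q′ and hence q above 1, the range in which `power-gap`
    -- applies.
    1<q′ᴷᴷ : 1ℚ ℚ.< q′ ^ (K * K)
    1<q′ᴷᴷ = ℚ.≤-<-trans (1≤ K K) a<q′ᴷᴷ
    1≤q : 1ℚ ℚ.≤ q
    1≤q = ℚ.<⇒≤ (ℚ.<-trans (^-cancel-< 1ℚ q′ (K * K) (ℚ.<⇒≤ 0<q′)
                   (subst (ℚ._< q′ ^ (K * K)) (sym (1^ (K * K))) 1<q′ᴷᴷ)) q′<q)
    gap = power-gap (ℚ.<⇒≤ 1<q′ᴷᴷ) (^-monoˡ-< q′ q (K * K) (ℚ.<⇒≤ 0<q′) q′<q)

  -- Bracket the limit between p and p + ε. The root eventually lies in the same bracket, so p + ε
  -- witnesses both inequalities of `Within`.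
  sandwich : ∀ ε → 0ℚ ℚ.< ε → ∃ λ N → ∀ s t v → N ≤ s → N ≤ t →
             a s t ≤ v → v ≤ a (suc s) (suc t) → Within ε (root v (suc s * suc t)) limit
  sandwich ε 0<ε =
    let p , p<ℓ , ℓ<p+ε = cauchy limit ε 0<ε
        M , low  = eventually-Lower p<ℓ
        N , high = eventually-Upper ℓ<p+ε
        p≡ = sym (p+ε-ε p)
    in M ℕ.⊔ N , λ s t v s≥ t≥ a≤v v≤a →
      (p ℚ.+ ε , high s t v (ℕ.≤-trans (ℕ.m≤n⊔m M N) s≥) (ℕ.≤-trans (ℕ.m≤n⊔m M N) t≥) v≤a
               , subst (Lower limit) p≡ p<ℓ) ,
      (p ℚ.+ ε , ℓ<p+ε
               , subst (Lower (root v (suc s * suc t))) p≡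
                   (low s t v (ℕ.≤-trans (ℕ.m≤m⊔n M N) s≥) (ℕ.≤-trans (ℕ.m≤m⊔n M N) t≥) a≤v))
    where
    p+ε-ε : ∀ p → p ℚ.+ ε ℚ.- ε ≡ p
    p+ε-ε p = trans (ℚ.+-assoc p ε (ℚ.- ε)) (trans (cong (p ℚ.+_) (ℚ.+-inverseʳ ε)) (ℚ.+-identityʳ p))

-- Counting by injections

lookup-injective : ∀ {A : Set} {xs : List A} → Unique xs → ∀ i j → List.lookup xs i ≡ List.lookup xs j → i ≡ j
lookup-injective (_  ∷ _) zero    zero    _  = refl
lookup-injective (x∉ ∷ _) zero    (suc j) eq = contradiction eq (All.lookup x∉ (∈-lookup j))
lookup-injective (x∉ ∷ _) (suc i) zero    eq = contradiction (sym eq) (All.lookup x∉ (∈-lookup i))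
lookup-injective (_  ∷ u) (suc i) (suc j) eq = cong suc (lookup-injective u i j eq)

module _ {A B : Set} where

  -- Each position in `xs` goes to the position in `ys` where its image is found; this map of finite
  -- index sets is injective because `xs` has no repetitions.
  length-injection : {xs : List A} {ys : List B} → Unique xs → (f : A → B) →
                     (∀ {x y} → f x ≡ f y → x ≡ y) → (∀ {x} → x ∈ xs → f x ∈ ys) →
                     length xs ≤ length ys
  length-injection {xs} {ys} unique f f-inj f∈ = Fin.injective⇒≤ {f = index} index-inj
    where
    index : Fin (length xs) → Fin (length ys)
    index i = Any.index (f∈ (∈-lookup {xs = xs} i))
    index-inj : ∀ {i j} → index i ≡ index j → i ≡ j
    index-inj {i} {j} eq = lookup-injective unique i j
      (f-inj (SetoidMembership.index-injective (setoid B) (f∈ (∈-lookup i)) (f∈ (∈-lookup j)) eq))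

  length-cartesianProduct : (xs : List A) (ys : List B) →
                            length (cartesianProduct xs ys) ≡ length xs * length ys
  length-cartesianProduct []       ys = refl
  length-cartesianProduct (x ∷ xs) ys = trans (List.length-++ (map (x ,_) ys))
    (cong₂ _+_ (List.length-map (x ,_) ys) (length-cartesianProduct xs ys))

∈-vectors : ∀ {A : Set} {xs : List A} → (∀ x → x ∈ xs) → ∀ {n} (v : Vec A n) → v ∈ vectors xs n
∈-vectors ∈xs []      = here refl
∈-vectors ∈xs (x ∷ v) = ∈-cartesianProductWith⁺ _∷_ (∈xs x) (∈-vectors ∈xs v)

vectors-unique : ∀ {A : Set} {xs : List A} → Unique xs → ∀ n → Unique (vectors xs n)
vectors-unique unique zero    = [] ∷ []
vectors-unique unique (suc n) = Unique.cartesianProductWith⁺ _∷_ Vec.∷-injective unique (vectors-unique unique n)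

∈-arrays : ∀ {r c} (A : Vec (Vec Bool c) r) → A ∈ arrays r c
∈-arrays = ∈-vectors (∈-vectors λ { false → here refl ; true → there (here refl) })

arrays-unique : ∀ r c → Unique (arrays r c)
arrays-unique r c = vectors-unique (vectors-unique (((λ ()) ∷ []) ∷ [] ∷ []) c) r

toArray : ∀ {r c} → (Vertex r c → Bool) → Vec (Vec Bool c) r
toArray S = tabulate λ i → tabulate λ j → S (i , j)

support-toArray : ∀ {r c} (S : Vertex r c → Bool) → support (toArray S) ≗ S
support-toArray S (i , j) = trans
  (cong (λ v → lookup v j) (Vec.lookup∘tabulate (λ i → tabulate λ j → S (i , j)) i))
  (Vec.lookup∘tabulate (λ j → S (i , j)) j)

lookup-extensional : ∀ {A : Set} {n} (v w : Vec A n) → lookup v ≗ lookup w → v ≡ w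
lookup-extensional v w eq = trans (sym (Vec.tabulate∘lookup v))
  (trans (Vec.tabulate-cong eq) (Vec.tabulate∘lookup w))

support-injective : ∀ {r c} {A B : Vec (Vec Bool c) r} → support A ≗ support B → A ≡ B
support-injective {A = A} {B} eq = lookup-extensional A B λ i →
  lookup-extensional (lookup A i) (lookup B i) λ j → eq (i , j)

toArray-injective : ∀ {r c} {S S′ : Vertex r c → Bool} → toArray S ≡ toArray S′ → S ≗ S′
toArray-injective {S = S} {S′} eq v =
  trans (sym (support-toArray S v)) (trans (cong (λ A → support A v) eq) (support-toArray S′ v))

Independent-resp-≗ : ∀ {V : Set} (G : Graph V) {S S′} → S ≗ S′ → Independent G S → Independent G S′
Independent-resp-≗ G eq ind u v u∈ v∈ = ind u v (subst T (sym (eq u)) u∈) (subst T (sym (eq v)) v∈)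

independents : ∀ {r c} → Graph (Vertex r c) → List (Vec (Vec Bool c) r)
independents {r} {c} G = filter (λ A → independent? G (support A)) (arrays r c)

module _ {r c} (G : Graph (Vertex r c)) where

  independents-unique : Unique (independents G)
  independents-unique = Unique.filter⁺ (λ A → independent? G (support A)) (arrays-unique r c)

  ∈-independents⁻ : ∀ {A} → A ∈ independents G → Independent G (support A)
  ∈-independents⁻ A∈ = proj₂ (∈-filter⁻ (λ A → independent? G (support A)) {xs = arrays r c} A∈)

  ∈-independents⁺ : ∀ {S} → Independent G S → toArray S ∈ independents G
  ∈-independents⁺ {S} ind = ∈-filter⁺ (λ A → independent? G (support A)) (∈-arrays (toArray S))
    (Independent-resp-≗ G (λ v → sym (support-toArray S v)) ind)

Subset : ℕ → ℕ → Set
Subset r c = Vertex r c → Bool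

module _ {r c r₁ c₁} (G : Graph (Vertex r c)) (G₁ : Graph (Vertex r₁ c₁)) where

  -- Injectivity is taken up to pointwise equality of characteristic functions; encoding subsets as
  -- arrays turns this into propositional equality, on which counting by lists rests.
  #independent-injection : (φ : Subset r c → Subset r₁ c₁) →
    (∀ {S} → Independent G S → Independent G₁ (φ S)) →
    (∀ {S S′} → φ S ≗ φ S′ → S ≗ S′) →
    #independent G ≤ #independent G₁
  #independent-injection φ φ-ind φ-inj = length-injection (independents-unique G)
    (toArray ∘ φ ∘ support)
    (support-injective ∘ φ-inj ∘ toArray-injective)
    (∈-independents⁺ G₁ ∘ φ-ind ∘ ∈-independents⁻ G)

module _ {r c r₁ c₁ r₂ c₂} (G : Graph (Vertex r c))
         (G₁ : Graph (Vertex r₁ c₁)) (G₂ : Graph (Vertex r₂ c₂)) where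

  private
    pairs = cartesianProduct (independents G₁) (independents G₂)

  #independent-split : (φ₁ : Subset r c → Subset r₁ c₁) (φ₂ : Subset r c → Subset r₂ c₂) →
    (∀ {S} → Independent G S → Independent G₁ (φ₁ S)) →
    (∀ {S} → Independent G S → Independent G₂ (φ₂ S)) →
    (∀ {S S′} → φ₁ S ≗ φ₁ S′ → φ₂ S ≗ φ₂ S′ → S ≗ S′) →
    #independent G ≤ #independent G₁ * #independent G₂
  #independent-split φ₁ φ₂ ind₁ ind₂ φ-inj =
    subst (#independent G ≤_) (length-cartesianProduct (independents G₁) (independents G₂))
      (length-injection {ys = pairs} (independents-unique G)
        (λ A → toArray (φ₁ (support A)) , toArray (φ₂ (support A)))
        (λ eq → support-injective (φ-inj (toArray-injective (cong proj₁ eq)) (toArray-injective (cong proj₂ eq))))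
        (λ A∈ → ∈-cartesianProduct⁺ (∈-independents⁺ G₁ (ind₁ (∈-independents⁻ G A∈)))
                                    (∈-independents⁺ G₂ (ind₂ (∈-independents⁻ G A∈)))))

  #independent-glue : (ψ : Subset r₁ c₁ → Subset r₂ c₂ → Subset r c) →
    (∀ {S₁ S₂} → Independent G₁ S₁ → Independent G₂ S₂ → Independent G (ψ S₁ S₂)) →
    (∀ {S₁ S₂ S₁′ S₂′} → ψ S₁ S₂ ≗ ψ S₁′ S₂′ → S₁ ≗ S₁′ × S₂ ≗ S₂′) →
    #independent G₁ * #independent G₂ ≤ #independent G
  #independent-glue ψ ψ-ind ψ-inj =
    subst (_≤ #independent G) (length-cartesianProduct (independents G₁) (independents G₂))
      (length-injection {xs = pairs} {ys = independents G}
        (Unique.cartesianProduct⁺ (independents-unique G₁) (independents-unique G₂))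
        (λ (A₁ , A₂) → toArray (ψ (support A₁) (support A₂)))
        (λ eq → let eq₁ , eq₂ = ψ-inj (toArray-injective eq)
                in cong₂ _,_ (support-injective eq₁) (support-injective eq₂))
        (λ A∈ → let A₁∈ , A₂∈ = ∈-cartesianProduct⁻ (independents G₁) (independents G₂) A∈
                in ∈-independents⁺ G (ψ-ind (∈-independents⁻ G₁ A₁∈) (∈-independents⁻ G₂ A₂∈))))

-- Translation invariance

T-does⁺ : ∀ {P : Set} (p? : Dec P) → P → T (does p?)
T-does⁺ (yes _) _ = tt
T-does⁺ (no ¬p) p = ¬p p

T-does⁻ : ∀ {P : Set} (p? : Dec P) → T (does p?) → P
T-does⁻ (yes p) _ = p

-- This says that the set of the two sites is independent, which is what the transfer matrices can
-- detect. They do not see edges at a looped site, so adjacency alone need not be translation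
-- invariant.
Compatible : {V : Set} → Graph V → V → V → Set
Compatible G u v = ¬ (u ~ u) × ¬ (v ~ v) × ¬ (u ~ v)
  where open Graph G

module _ {V : Set} (G : Graph V) where
  open Graph G

  Compatible-sym : ∀ {u v} → Compatible G u v → Compatible G v u
  Compatible-sym (¬uu , ¬vv , ¬uv) = ¬vv , ¬uu , ¬uv ∘ ~-sym

  independent-compatible : ∀ {S u v} → Independent G S → T (S u) → T (S v) → Compatible G u v
  independent-compatible {u = u} {v} ind u∈ v∈ = ind u u u∈ u∈ , ind v v v∈ v∈ , ind u v u∈ v∈

  compatible-independent : ∀ {S u v} → Compatible G u v → (∀ w → T (S w) → w ≡ u ⊎ w ≡ v) → Independent G S
  compatible-independent (¬uu , ¬vv , ¬uv) ⊆uv x y x∈ y∈ x~y with ⊆uv x x∈ | ⊆uv y y∈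
  ... | inj₁ refl | inj₁ refl = ¬uu x~y
  ... | inj₁ refl | inj₂ refl = ¬uv x~y
  ... | inj₂ refl | inj₁ refl = ¬uv (~-sym x~y)
  ... | inj₂ refl | inj₂ refl = ¬vv x~y

pair : ∀ {k} → Fin k → Fin k → Vec Bool k
pair x y = tabulate λ z → does (z Fin.≟ x) ∨ does (z Fin.≟ y)

module _ {k} (x y : Fin k) where

  ∈-pair⁻ : ∀ z → T (lookup (pair x y) z) → z ≡ x ⊎ z ≡ y
  ∈-pair⁻ z z∈ = Sum.map (T-does⁻ (z Fin.≟ x)) (T-does⁻ (z Fin.≟ y))
    (Equivalence.to T-∨ (subst T (Vec.lookup∘tabulate _ z) z∈))

  ∈-pair⁺ : ∀ {z} → z ≡ x ⊎ z ≡ y → T (lookup (pair x y) z)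
  ∈-pair⁺ {z} z≡ = subst T (sym (Vec.lookup∘tabulate _ z))
    (Equivalence.from T-∨ (Sum.map (T-does⁺ (z Fin.≟ x)) (T-does⁺ (z Fin.≟ y)) z≡))

T-indicator⁻ : ∀ {b} → (if b then 1 else 0) ≡ 1 → T b
T-indicator⁻ {true} _ = tt

indicator-true : ∀ {b} → T b → (if b then 1 else 0) ≡ 1
indicator-true {true} _ = refl

module _ {k} {A B C : Matrix k} (A≈C : A ≈ C) (B≈C : B ≈ C) where
  open _≈_

  rowIndex-transfer : ∀ α → T (rowIndex A α) → T (rowIndex B α)
  rowIndex-transfer α = subst T (trans (rowIndex-≗ A≈C α) (sym (rowIndex-≗ B≈C α)))

  colIndex-transfer : ∀ α → T (colIndex A α) → T (colIndex B α)
  colIndex-transfer α = subst T (trans (colIndex-≗ A≈C α) (sym (colIndex-≗ B≈C α)))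

  entry-transfer : ∀ α β → T (rowIndex A α) → T (colIndex A β) → entry A α β ≡ entry B α β
  entry-transfer α β α∈ β∈ = trans (entry-≡ A≈C α β α∈ β∈)
    (sym (entry-≡ B≈C α β (rowIndex-transfer α α∈) (colIndex-transfer β β∈)))

-- All later estimates draw on the transfer matrices through this record. Offsets from two base
-- lines express translation in either direction without subtraction.
record Homogeneous (L : Lattice) : Set where
  open Graph L
  field
    rowwise     : ∀ {i j i′ j′} → (i , j) ~ (i′ , j′) → ∣ i - i′ ∣ ≤ 1
    columnwise  : ∀ {i j i′ j′} → (i , j) ~ (i′ , j′) → ∣ j - j′ ∣ ≤ 1
    shiftRow    : ∀ s s′ a b {j j′} → Compatible L (s + a , j) (s + b , j′) → Compatible L (s′ + a , j) (s′ + b , j′)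
    shiftColumn : ∀ t t′ a b {i i′} → Compatible L (i , t + a) (i′ , t + b) → Compatible L (i , t′ + a) (i′ , t′ + b)

  shift : ∀ s s′ t t′ {a b c d} → Compatible L (s + a , t + c) (s + b , t + d) →
          Compatible L (s′ + a , t′ + c) (s′ + b , t′ + d)
  shift s s′ t t′ {a} {b} {c} {d} = shiftColumn t t′ c d ∘ shiftRow s s′ a b

-- The recursion moves common successors of a and b into the base points until one offset is 0. The
-- offsets then differ by 0, by 1 in one of two orders, or by at least 2, and each case has its
-- hypothesis.
translation-invariant : (C : ℕ → ℕ → Set) →
  (∀ t t′ → C t t → C t′ t′) →
  (∀ t t′ → C t (suc t) → C t′ (suc t′)) →
  (∀ t t′ → C (suc t) t → C (suc t′) t′) →
  (∀ {t t′ u u′} → C t t′ → ¬ (∣ u - u′ ∣ ≤ 1) → C u u′) →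
  ∀ t t′ a b → C (t + a) (t + b) → C (t′ + a) (t′ + b)
translation-invariant C same up down far = go
  where
  go : ∀ t t′ a b → C (t + a) (t + b) → C (t′ + a) (t′ + b)
  go t t′ zero zero = same (t + 0) (t′ + 0)
  go t t′ zero (suc zero) c =
    subst (C (t′ + 0)) (sym (ℕ.+-suc t′ 0)) (up (t + 0) (t′ + 0) (subst (C (t + 0)) (ℕ.+-suc t 0) c))
  go t t′ (suc zero) zero c =
    subst (λ x → C x (t′ + 0)) (sym (ℕ.+-suc t′ 0)) (down (t + 0) (t′ + 0) (subst (λ x → C x (t + 0)) (ℕ.+-suc t 0) c))
  go t t′ zero (suc (suc b)) c = far c λ le → ℕ.1+n≰n (ℕ.≤-trans (s≤s (s≤s z≤n))
    (subst (_≤ 1) (ℕ.∣m+n-m+o∣≡∣n-o∣ t′ 0 (suc (suc b))) le))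
  go t t′ (suc (suc a)) zero c = far c λ le → ℕ.1+n≰n (ℕ.≤-trans (s≤s (s≤s z≤n))
    (subst (_≤ 1) (ℕ.∣m+n-m+o∣≡∣n-o∣ t′ (suc (suc a)) 0) le))
  go t t′ (suc a) (suc b) c = subst₂ C (sym (ℕ.+-suc t′ a)) (sym (ℕ.+-suc t′ b))
    (go (suc t) (suc t′) a b (subst₂ C (ℕ.+-suc t a) (ℕ.+-suc t b) c))

module _ {L : Lattice} (t : TransferMultiplicityOne L) where

  private
    C : ℕ → ℕ → ℕ → ℕ → Set
    C i j i′ j′ = Compatible L (i , j) (i′ , j′)

    -- The second line of a two-line block has coordinate `t + 1`, but `suc t + 0` in the one-line
    -- block that starts there.
    successor-loop : ∀ {V : Set} (G : Graph V) {P : ℕ → V} t → Compatible G (P (t + 1)) (P (t + 1)) →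
                     Compatible G (P (suc t + 0)) (P (suc t + 0))
    successor-loop G {P} t = subst (λ u → Compatible G (P u) (P u)) (ℕ.+-suc t 0)

  module _ (k j j′ : ℕ) (x y : Fin (suc (suc k))) where

    private
      K : ℕ
      K = suc (suc k)
      A≈ = columnSteps t (suc k)

      ⊆column : ∀ {x y : Fin K} (w : Vertex K 1) → T (column (pair x y) w) → w ≡ (x , zero) ⊎ w ≡ (y , zero)
      ⊆column {x} {y} (z , zero) z∈ = Sum.map (cong (_, zero)) (cong (_, zero)) (∈-pair⁻ x y z z∈)

      ⊆columns : (w : Vertex K 2) → T (twoColumns (pair x x) (pair y y) w) → w ≡ (x , zero) ⊎ w ≡ (y , suc zero)
      ⊆columns (z , zero)     z∈ = inj₁ (cong (_, zero) ([ id , id ] (∈-pair⁻ x x z z∈)))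
      ⊆columns (z , suc zero) z∈ = inj₂ (cong (_, suc zero) ([ id , id ] (∈-pair⁻ y y z z∈)))

      column∈ : ∀ j {x y} → C (toℕ x) (j + 0) (toℕ y) (j + 0) →
                T (does (independent? (block L 0 j K 1) (column (pair x y))))
      column∈ j {x} {y} c = T-does⁺ (independent? (block L 0 j K 1) (column (pair x y)))
        (compatible-independent (block L 0 j K 1) {column (pair x y)} {x , zero} {y , zero} c ⊆column)

    -- Compatibility within a column means that the vector of the pair belongs to the index set, and
    -- that set is the same at every step.
    shift-column : C (toℕ x) (j + 0) (toℕ y) (j + 0) → C (toℕ x) (j′ + 0) (toℕ y) (j′ + 0)
    shift-column c = independent-compatible (block L 0 j′ K 1) {column (pair x y)} {x , zero} {y , zero}
      (T-does⁻ (independent? (block L 0 j′ K 1) (column (pair x y)))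
        (rowIndex-transfer (A≈ j) (A≈ j′) (pair x y) (column∈ j c)))
      (∈-pair⁺ x y (inj₁ refl)) (∈-pair⁺ x y (inj₂ refl))

    -- Compatibility across consecutive columns is the matrix entry at two singletons. Since neither
    -- site carries a loop, both singletons lie in the index sets, where entries of different steps
    -- agree.
    shift-columns : C (toℕ x) (j + 0) (toℕ y) (j + 1) → C (toℕ x) (j′ + 0) (toℕ y) (j′ + 1)
    shift-columns c@(¬xx , ¬yy , _) =
      independent-compatible (block L 0 j′ K 2) {twoColumns (pair x x) (pair y y)} {x , zero} {y , suc zero}
        (T-does⁻ (independent? (block L 0 j′ K 2) (twoColumns (pair x x) (pair y y)))
          (T-indicator⁻ (trans
            (sym (entry-transfer (A≈ j) (A≈ j′) (pair x x) (pair y y)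
              (column∈ j (¬xx , ¬xx , ¬xx))
              (column∈ (suc j) (successor-loop L {toℕ y ,_} j (¬yy , ¬yy , ¬yy)))))
            (indicator-true (T-does⁺ (independent? (block L 0 j K 2) (twoColumns (pair x x) (pair y y)))
              (compatible-independent (block L 0 j K 2) {twoColumns (pair x x) (pair y y)} {x , zero} {y , suc zero} c ⊆columns))))))
        (∈-pair⁺ x x (inj₁ refl)) (∈-pair⁺ y y (inj₁ refl))

  module _ (k i i′ : ℕ) (x y : Fin (suc (suc k))) where

    private
      K : ℕ
      K = suc (suc k)
      A≈ = rowSteps t (suc k)

      ⊆row : ∀ {x y : Fin K} (w : Vertex 1 K) → T (row (pair x y) w) → w ≡ (zero , x) ⊎ w ≡ (zero , y)
      ⊆row {x} {y} (zero , z) z∈ = Sum.map (cong (zero ,_)) (cong (zero ,_)) (∈-pair⁻ x y z z∈)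

      ⊆rows : (w : Vertex 2 K) → T (twoRows (pair x x) (pair y y) w) → w ≡ (zero , x) ⊎ w ≡ (suc zero , y)
      ⊆rows (zero , z)     z∈ = inj₁ (cong (zero ,_) ([ id , id ] (∈-pair⁻ x x z z∈)))
      ⊆rows (suc zero , z) z∈ = inj₂ (cong (suc zero ,_) ([ id , id ] (∈-pair⁻ y y z z∈)))

      row∈ : ∀ i {x y} → C (i + 0) (toℕ x) (i + 0) (toℕ y) →
             T (does (independent? (block L i 0 1 K) (row (pair x y))))
      row∈ i {x} {y} c = T-does⁺ (independent? (block L i 0 1 K) (row (pair x y)))
        (compatible-independent (block L i 0 1 K) {row (pair x y)} {zero , x} {zero , y} c ⊆row)

    shift-row : C (i + 0) (toℕ x) (i + 0) (toℕ y) → C (i′ + 0) (toℕ x) (i′ + 0) (toℕ y)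
    shift-row c = independent-compatible (block L i′ 0 1 K) {row (pair x y)} {zero , x} {zero , y}
      (T-does⁻ (independent? (block L i′ 0 1 K) (row (pair x y)))
        (rowIndex-transfer (A≈ i) (A≈ i′) (pair x y) (row∈ i c)))
      (∈-pair⁺ x y (inj₁ refl)) (∈-pair⁺ x y (inj₂ refl))

    shift-rows : C (i + 0) (toℕ x) (i + 1) (toℕ y) → C (i′ + 0) (toℕ x) (i′ + 1) (toℕ y)
    shift-rows c@(¬xx , ¬yy , _) =
      independent-compatible (block L i′ 0 2 K) {twoRows (pair x x) (pair y y)} {zero , x} {suc zero , y}
        (T-does⁻ (independent? (block L i′ 0 2 K) (twoRows (pair x x) (pair y y)))
          (T-indicator⁻ (trans
            (sym (entry-transfer (A≈ i) (A≈ i′) (pair x x) (pair y y)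
              (row∈ i (¬xx , ¬xx , ¬xx))
              (row∈ (suc i) (successor-loop L {_, toℕ y} i (¬yy , ¬yy , ¬yy)))))
            (indicator-true (T-does⁺ (independent? (block L i 0 2 K) (twoRows (pair x x) (pair y y)))
              (compatible-independent (block L i 0 2 K) {twoRows (pair x x) (pair y y)} {zero , x} {suc zero , y} c ⊆rows))))))
        (∈-pair⁺ x x (inj₁ refl)) (∈-pair⁺ y y (inj₁ refl))

  private

    -- Any two positions fit into one sufficiently long vector, so facts about matrices of every
    -- size reach all pairs of natural numbers.
    on-line : (P : ℕ → ℕ → Set) → (∀ k (x y : Fin (suc (suc k))) → P (toℕ x) (toℕ y)) → ∀ a b → P a b
    on-line P p a b = subst₂ P (Fin.toℕ-fromℕ< a<) (Fin.toℕ-fromℕ< b<) (p (a ℕ.⊔ b) (fromℕ< a<) (fromℕ< b<))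
      where
      a< : a < suc (suc (a ℕ.⊔ b))
      a< = s≤s (ℕ.m≤n⇒m≤1+n (ℕ.m≤m⊔n a b))
      b< : b < suc (suc (a ℕ.⊔ b))
      b< = s≤s (ℕ.m≤n⇒m≤1+n (ℕ.m≤n⊔m a b))

    +0 : ∀ {i} → i + 0 ≡ i
    +0 = ℕ.+-identityʳ _

    +1 : ∀ {i} → i + 1 ≡ suc i
    +1 = ℕ.+-comm _ 1

    column-same : ∀ i i′ j j′ → C i j i′ j → C i j′ i′ j′
    column-same i i′ j j′ = on-line (λ i i′ → C i j i′ j → C i j′ i′ j′)
      (λ k x y → subst₂ (λ j j′ → C (toℕ x) j (toℕ y) j → C (toℕ x) j′ (toℕ y) j′) +0 +0
                   (shift-column k j j′ x y)) i i′

    column-next : ∀ i i′ j j′ → C i j i′ (suc j) → C i j′ i′ (suc j′)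
    column-next i i′ j j′ = on-line (λ i i′ → C i j i′ (suc j) → C i j′ i′ (suc j′))
      (λ k x y c → subst₂ (λ j j⁺ → C (toℕ x) j (toℕ y) j⁺) +0 +1
                     (shift-columns k j j′ x y (subst₂ (λ j j⁺ → C (toℕ x) j (toℕ y) j⁺) (sym +0) (sym +1) c))) i i′

    row-same : ∀ j j′ i i′ → C i j i j′ → C i′ j i′ j′
    row-same j j′ i i′ = on-line (λ j j′ → C i j i j′ → C i′ j i′ j′)
      (λ k x y → subst₂ (λ i i′ → C i (toℕ x) i (toℕ y) → C i′ (toℕ x) i′ (toℕ y)) +0 +0
                   (shift-row k i i′ x y)) j j′

    row-next : ∀ j j′ i i′ → C i j (suc i) j′ → C i′ j (suc i′) j′
    row-next j j′ i i′ = on-line (λ j j′ → C i j (suc i) j′ → C i′ j (suc i′) j′)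
      (λ k x y c → subst₂ (λ i i⁺ → C i (toℕ x) i⁺ (toℕ y)) +0 +1
                     (shift-rows k i i′ x y (subst₂ (λ i i⁺ → C i (toℕ x) i⁺ (toℕ y)) (sym +0) (sym +1) c))) j j′

  homogeneous : Homogeneous L
  homogeneous = record
    { rowwise     = rowLocal t
    ; columnwise  = columnLocal t
    ; shiftRow    = λ s s′ a b {j} {j′} → translation-invariant (λ i i′ → C i j i′ j′)
        (row-same j j′) (row-next j j′)
        (λ i i′ → Compatible-sym L ∘ row-next j′ j i i′ ∘ Compatible-sym L)
        -- Sites two or more lines apart are never adjacent, so only the absence of loops has to be
        -- carried over, as compatibility of a site with itself.
        (λ {i} {i′} {l} {l′} (¬uu , ¬vv , _) far →
          proj₁ (row-same j j i l (¬uu , ¬uu , ¬uu)) ,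
          proj₁ (row-same j′ j′ i′ l′ (¬vv , ¬vv , ¬vv)) ,
          far ∘ rowLocal t)
        s s′ a b
    ; shiftColumn = λ s s′ a b {i} {i′} → translation-invariant (λ j j′ → C i j i′ j′)
        (column-same i i′) (column-next i i′)
        (λ j j′ → Compatible-sym L ∘ column-next i′ i j j′ ∘ Compatible-sym L)
        (λ {j} {j′} {l} {l′} (¬uu , ¬vv , _) far →
          proj₁ (column-same i i j l (¬uu , ¬uu , ¬uu)) ,
          proj₁ (column-same i′ i′ j′ l′ (¬vv , ¬vv , ¬vv)) ,
          far ∘ columnLocal t)
        s s′ a b
    }

-- Blocks

#block : Lattice → ℕ → ℕ → ℕ
#block L r c = #independent (block L 0 0 r c)

#block-zeroRows : ∀ L c → #block L 0 c ≤ 1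
#block-zeroRows L c = List.length-filter (λ X → independent? (block L 0 0 0 c) (support X)) (arrays 0 c)

#block-positive : ∀ L r c → 1 ≤ #block L r c
#block-positive L r c = ℕ.≤-trans (ℕ.≤-reflexive 1≡#block)
  (#independent-injection (block L 0 0 0 0) (block L 0 0 r c) (λ _ _ → false) (λ _ _ _ ()) λ { _ (() , _) })
  where
  1≡#block : 1 ≡ #block L 0 0
  1≡#block = refl

-- Transposition allows every estimate to be proved for rows only.
_ᵀ : Lattice → Lattice
L ᵀ = induced swap L

#block-transpose : ∀ L r c → #block L r c ≤ #block (L ᵀ) c r
#block-transpose L r c = #independent-injection (block L 0 0 r c) (block (L ᵀ) 0 0 c r)
  (_∘ swap) (λ ind u v → ind (swap u) (swap v)) (λ eq v → eq (swap v))

transpose-homogeneous : ∀ {L} → Homogeneous L → Homogeneous (L ᵀ)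
transpose-homogeneous hom = record
  { rowwise     = columnwise
  ; columnwise  = rowwise
  ; shiftRow    = λ s s′ a b → shiftColumn s s′ a b
  ; shiftColumn = λ t t′ a b → shiftRow t t′ a b
  }
  where open Homogeneous hom

module Glue {r₁ r₂ c : ℕ} where

  glue : Subset r₁ c → Subset r₂ c → Subset (r₁ + suc r₂) c
  glue S₁ S₂ (i , j) with splitAt r₁ i
  ... | inj₁ i₁       = S₁ (i₁ , j)
  ... | inj₂ zero     = false
  ... | inj₂ (suc i₂) = S₂ (i₂ , j)

  glue-above : ∀ S₁ S₂ i j → glue S₁ S₂ (i ↑ˡ suc r₂ , j) ≡ S₁ (i , j)
  glue-above S₁ S₂ i j rewrite Fin.splitAt-↑ˡ r₁ i (suc r₂) = refl

  glue-below : ∀ S₁ S₂ i j → glue S₁ S₂ (r₁ ↑ʳ suc i , j) ≡ S₂ (i , j)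
  glue-below S₁ S₂ i j rewrite Fin.splitAt-↑ʳ r₁ (suc r₂) (suc i) = refl

  ∈-glue⁻ : ∀ {S₁ S₂} i j → T (glue S₁ S₂ (i , j)) →
            (∃ λ i₁ → toℕ i ≡ toℕ i₁ × T (S₁ (i₁ , j))) ⊎
            (∃ λ i₂ → toℕ i ≡ r₁ + suc (toℕ i₂) × T (S₂ (i₂ , j)))
  ∈-glue⁻ i j i∈ with splitAt r₁ i in eq
  ... | inj₁ i₁       = inj₁ (i₁ , trans (cong toℕ (sym (Fin.splitAt⁻¹-↑ˡ eq))) (Fin.toℕ-↑ˡ i₁ (suc r₂)) , i∈)
  ... | inj₂ (suc i₂) = inj₂ (i₂ , trans (cong toℕ (sym (Fin.splitAt⁻¹-↑ʳ eq))) (Fin.toℕ-↑ʳ r₁ (suc i₂)) , i∈)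

open Glue

-- Line r is the empty one: a lies before it and r + suc b after it, hence at distance at least 2.
separated : ∀ {a r b} → a < r → ¬ (∣ a - r + suc b ∣ ≤ 1)
separated {a} {r} {b} a<r d≤1 = ℕ.<-irrefl refl (begin-strict
  r + suc b                   ≤⟨ ℕ.m≤n+∣n-m∣ (r + suc b) a ⟩
  a + ∣ a - r + suc b ∣       ≤⟨ ℕ.+-monoʳ-≤ a d≤1 ⟩
  a + 1                       ≡⟨ ℕ.+-comm a 1 ⟩
  suc a                       ≤⟨ a<r ⟩
  r                           <⟨ ℕ.m<m+n r (s≤s z≤n) ⟩
  r + suc b                   ∎)
  where open ℕ.≤-Reasoning

not-adjacent : ∀ {V : Set} (G : Graph V) {u v} → Compatible G u v → ¬ Graph._~_ G u v
not-adjacent G (_ , _ , ¬uv) = ¬uv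

module Blocks {L : Lattice} (hom : Homogeneous L) where
  open Graph L
  open Homogeneous hom

  -- A set is determined by its restrictions to the first r₁ and the last r₂ rows; `shiftRow` moves
  -- the latter back to the origin.
  #block-split : ∀ r₁ r₂ c → #block L (r₁ + r₂) c ≤ #block L r₁ c * #block L r₂ c
  #block-split r₁ r₂ c = #independent-split (block L 0 0 (r₁ + r₂) c) (block L 0 0 r₁ c) (block L 0 0 r₂ c)
    (λ S (i , j) → S (i ↑ˡ r₂ , j)) (λ S (i , j) → S (r₁ ↑ʳ i , j))
    (λ {S} ind (i , j) (i′ , j′) u∈ v∈ u~v → ind (i ↑ˡ r₂ , j) (i′ ↑ˡ r₂ , j′) u∈ v∈
      (subst₂ (λ x y → (x , toℕ j) ~ (y , toℕ j′)) (sym (Fin.toℕ-↑ˡ i r₂)) (sym (Fin.toℕ-↑ˡ i′ r₂)) u~v))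
    (λ {S} ind (i , j) (i′ , j′) u∈ v∈ → not-adjacent L (shiftRow r₁ 0 (toℕ i) (toℕ i′)
      (subst₂ (λ x y → Compatible L (x , toℕ j) (y , toℕ j′)) (Fin.toℕ-↑ʳ r₁ i) (Fin.toℕ-↑ʳ r₁ i′)
        (independent-compatible (block L 0 0 (r₁ + r₂) c) {S} {r₁ ↑ʳ i , j} {r₁ ↑ʳ i′ , j′} ind u∈ v∈))))
    (λ {S} {S′} eq₁ eq₂ (i , j) → extend S S′ eq₁ eq₂ i j)
    where
    extend : ∀ S S′ → (λ (i , j) → S (i ↑ˡ r₂ , j)) ≗ (λ (i , j) → S′ (i ↑ˡ r₂ , j)) →
             (λ (i , j) → S (r₁ ↑ʳ i , j)) ≗ (λ (i , j) → S′ (r₁ ↑ʳ i , j)) →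
             ∀ i (j : Fin c) → S (i , j) ≡ S′ (i , j)
    extend S S′ eq₁ eq₂ i j with splitAt r₁ i in eq
    ... | inj₁ i₁ = subst (λ i → S (i , j) ≡ S′ (i , j)) (Fin.splitAt⁻¹-↑ˡ eq) (eq₁ (i₁ , j))
    ... | inj₂ i₂ = subst (λ i → S (i , j) ≡ S′ (i , j)) (Fin.splitAt⁻¹-↑ʳ eq) (eq₂ (i₂ , j))

  #block-glue : ∀ r₁ r₂ c → #block L r₁ c * #block L r₂ c ≤ #block L (r₁ + suc r₂) c
  #block-glue r₁ r₂ c = #independent-glue (block L 0 0 (r₁ + suc r₂) c) (block L 0 0 r₁ c) (block L 0 0 r₂ c)
    glue
    (λ {S₁} {S₂} → glue-independent {S₁} {S₂})
    (λ {S₁} {S₂} {S₁′} {S₂′} eq →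
      (λ (i , j) → trans (sym (glue-above S₁ S₂ i j)) (trans (eq (i ↑ˡ suc r₂ , j)) (glue-above S₁′ S₂′ i j))) ,
      (λ (i , j) → trans (sym (glue-below S₁ S₂ i j)) (trans (eq (r₁ ↑ʳ suc i , j)) (glue-below S₁′ S₂′ i j))))
    where
    glue-independent : ∀ {S₁ S₂} → Independent (block L 0 0 r₁ c) S₁ → Independent (block L 0 0 r₂ c) S₂ →
                       Independent (block L 0 0 (r₁ + suc r₂) c) (glue S₁ S₂)
    glue-independent {S₁} {S₂} ind₁ ind₂ (i , j) (i′ , j′) u∈ v∈ u~v
      with ∈-glue⁻ {S₁ = S₁} {S₂ = S₂} i j u∈ | ∈-glue⁻ {S₁ = S₁} {S₂ = S₂} i′ j′ v∈
    ... | inj₁ (a , i≡a , a∈) | inj₁ (b , i′≡b , b∈) = ind₁ (a , j) (b , j′) a∈ b∈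
      (subst₂ (λ x y → (x , toℕ j) ~ (y , toℕ j′)) i≡a i′≡b u~v)
    ... | inj₁ (a , i≡a , a∈) | inj₂ (b , i′≡b , b∈) = separated (Fin.toℕ<n a)
      (subst₂ (λ x y → ∣ x - y ∣ ≤ 1) i≡a i′≡b (rowwise u~v))
    ... | inj₂ (a , i≡a , a∈) | inj₁ (b , i′≡b , b∈) = separated (Fin.toℕ<n b)
      (subst₂ (λ x y → ∣ x - y ∣ ≤ 1) i′≡b i≡a (rowwise (~-sym u~v)))
    ... | inj₂ (a , i≡a , a∈) | inj₂ (b , i′≡b , b∈) = not-adjacent L
      (subst₂ (λ x y → Compatible L (x , toℕ j) (y , toℕ j′))
        (trans (sym (ℕ.+-suc r₁ (toℕ a))) (sym i≡a)) (trans (sym (ℕ.+-suc r₁ (toℕ b))) (sym i′≡b))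
        (shiftRow 0 (suc r₁) (toℕ a) (toℕ b)
          (independent-compatible (block L 0 0 r₂ c) {S₂} {a , j} {b , j′} ind₂ a∈ b∈)))
      u~v

  -- Adding d + 1 rows amounts to an empty row and a block of d rows, whose count is at least 1.
  #block-mono-rows : ∀ {r r′} c → r ≤ r′ → #block L r c ≤ #block L r′ c
  #block-mono-rows {r} c r≤r′ with ℕ.m≤n⇒∃[o]m+o≡n r≤r′
  ... | zero  , refl = ℕ.≤-reflexive (cong (λ r → #block L r c) (sym (ℕ.+-identityʳ r)))
  ... | suc d , refl = ℕ.≤-trans (ℕ.m≤m*n (#block L r c) (#block L d c) {{ℕ.>-nonZero (#block-positive L d c)}}) (#block-glue r d c)

  #block-tile-rows-≤ : ∀ r c k → #block L (k * r) c ≤ #block L r c ℕ.^ k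
  #block-tile-rows-≤ r c zero    = #block-zeroRows L c
  #block-tile-rows-≤ r c (suc k) = ℕ.≤-trans (#block-split r (k * r) c) (ℕ.*-monoʳ-≤ (#block L r c) (#block-tile-rows-≤ r c k))

  #block-tile-rows-≥ : ∀ r c k → #block L r c ℕ.^ k ≤ #block L (k * suc r) c
  #block-tile-rows-≥ r c zero    = #block-positive L 0 c
  #block-tile-rows-≥ r c (suc k) = ℕ.≤-trans (ℕ.*-monoʳ-≤ (#block L r c) (#block-tile-rows-≥ r c k))
    (ℕ.≤-trans (#block-glue r (k * suc r) c) (ℕ.≤-reflexive (cong (λ r → #block L r c) (ℕ.+-suc r (k * suc r)))))

module _ {L : Lattice} (hom : Homogeneous L) where
  open Blocks
  open ℕ.≤-Reasoning

  private
    homᵀ = transpose-homogeneous hom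

    #blockᵀ : ∀ r c → #block L r c ≡ #block (L ᵀ) c r
    #blockᵀ r c = ℕ.≤-antisym (#block-transpose L r c) (#block-transpose (L ᵀ) c r)

  -- Each two-dimensional bound is the row bound for the lattice combined with the row bound for its
  -- transpose.
  isGridCount : IsGridCount (#block L)
  isGridCount = record
    { positive = #block-positive L
    ; monotone = λ {r} {r′} {c} {c′} r≤r′ c≤c′ → begin
        #block L r c          ≤⟨ #block-mono-rows hom c r≤r′ ⟩
        #block L r′ c         ≡⟨ #blockᵀ r′ c ⟩
        #block (L ᵀ) c r′     ≤⟨ #block-mono-rows homᵀ r′ c≤c′ ⟩
        #block (L ᵀ) c′ r′    ≡⟨ #blockᵀ r′ c′ ⟨
        #block L r′ c′        ∎
    ; tile-≤ = λ r c k l → begin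
        #block L (k * r) (l * c)            ≤⟨ #block-tile-rows-≤ hom r (l * c) k ⟩
        #block L r (l * c) ℕ.^ k            ≡⟨ cong (ℕ._^ k) (#blockᵀ r (l * c)) ⟩
        #block (L ᵀ) (l * c) r ℕ.^ k        ≤⟨ ℕ.^-monoˡ-≤ k (#block-tile-rows-≤ homᵀ c r l) ⟩
        (#block (L ᵀ) c r ℕ.^ l) ℕ.^ k      ≡⟨ power (#block (L ᵀ) c r) l k ⟩
        #block (L ᵀ) c r ℕ.^ (k * l)        ≡⟨ cong (ℕ._^ (k * l)) (#blockᵀ r c) ⟨
        #block L r c ℕ.^ (k * l)            ∎
    ; tile-≥ = λ r c k l → begin
        #block L r c ℕ.^ (k * l)            ≡⟨ cong (ℕ._^ (k * l)) (#blockᵀ r c) ⟩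
        #block (L ᵀ) c r ℕ.^ (k * l)        ≡⟨ power (#block (L ᵀ) c r) l k ⟨
        (#block (L ᵀ) c r ℕ.^ l) ℕ.^ k      ≤⟨ ℕ.^-monoˡ-≤ k (#block-tile-rows-≥ homᵀ c r l) ⟩
        #block (L ᵀ) (l * suc c) r ℕ.^ k    ≡⟨ cong (ℕ._^ k) (#blockᵀ r (l * suc c)) ⟨
        #block L r (l * suc c) ℕ.^ k        ≤⟨ #block-tile-rows-≥ hom r (l * suc c) k ⟩
        #block L (k * suc r) (l * suc c)    ∎
    }
    where
    power : ∀ x l k → (x ℕ.^ l) ℕ.^ k ≡ x ℕ.^ (k * l)
    power x l k = trans (ℕ.^-*-assoc x l k) (cong (x ℕ.^_) (ℕ.*-comm l k))

-- Cylinder and torus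

toℕ-wrap : ∀ n (j : Fin (suc (suc n))) → toℕ (wrap (suc n) j) ≡ toℕ j ℕ.% suc n
toℕ-wrap n j = Fin.toℕ-fromℕ< (ℕ.m%n<n (toℕ j) (suc n))

wrap-inject₁ : ∀ n (j : Fin (suc n)) → wrap (suc n) (inject₁ j) ≡ j
wrap-inject₁ n j = Fin.toℕ-injective (trans (toℕ-wrap n (inject₁ j))
  (trans (cong (ℕ._% suc n) (Fin.toℕ-inject₁ j)) (ℕ.m<n⇒m%n≡m (Fin.toℕ<n j))))

wrap-cases : ∀ n (j : Fin (suc (suc n))) →
             toℕ j ≡ toℕ (wrap (suc n) j) ⊎ toℕ j ≡ suc n × toℕ (wrap (suc n) j) ≡ 0
wrap-cases n j with ℕ.m≤n⇒m<n∨m≡n (ℕ.≤-pred (Fin.toℕ<n j))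
... | inj₁ j<n = inj₁ (sym (trans (toℕ-wrap n j) (ℕ.m<n⇒m%n≡m j<n)))
... | inj₂ j≡n = inj₂ (j≡n , trans (toℕ-wrap n j) (trans (cong (ℕ._% suc n) j≡n) (ℕ.n%n≡0 (suc n))))

-- Adjacent lines whose images on the circle avoid the last position are not
-- separated by the cut, so they come from a common translation.
unwrap : ∀ n (j j′ : Fin (suc (suc n))) → ∣ toℕ j - toℕ j′ ∣ ≤ 1 →
         toℕ (wrap (suc n) j) < n → toℕ (wrap (suc n) j′) < n →
         ∃ λ s → toℕ j ≡ s + toℕ (wrap (suc n) j) × toℕ j′ ≡ s + toℕ (wrap (suc n) j′)
unwrap n j j′ close j< j′< with wrap-cases n j | wrap-cases n j′
... | inj₁ j≡          | inj₁ j′≡          = 0 , j≡ , j′≡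
... | inj₂ (j≡n , j↦0) | inj₂ (j′≡n , j′↦0) = suc n
  , trans j≡n (sym (trans (cong (suc n ℕ.+_) j↦0) (ℕ.+-identityʳ (suc n))))
  , trans j′≡n (sym (trans (cong (suc n ℕ.+_) j′↦0) (ℕ.+-identityʳ (suc n))))
... | inj₁ j≡          | inj₂ (j′≡n , _)   = ⊥-elim (separated j<
  (subst₂ (λ x y → ∣ x - y ∣ ≤ 1) j≡ (trans j′≡n (ℕ.+-comm 1 n)) close))
... | inj₂ (j≡n , _)   | inj₁ j′≡          = ⊥-elim (separated j′<
  (subst₂ (λ x y → ∣ x - y ∣ ≤ 1) j′≡ (trans j≡n (ℕ.+-comm 1 n)) (subst (_≤ 1) (ℕ.∣-∣-comm (toℕ j) (toℕ j′)) close)))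

unlast : ∀ {n} → Fin (suc n) → Maybe (Fin n)
unlast {zero}  zero    = nothing
unlast {suc n} zero    = just zero
unlast {suc n} (suc i) = Maybe.map suc (unlast i)

unlast-inject₁ : ∀ {n} (i : Fin n) → unlast (inject₁ i) ≡ just i
unlast-inject₁ zero    = refl
unlast-inject₁ (suc i) = cong (Maybe.map suc) (unlast-inject₁ i)

toℕ-unlast : ∀ {n} (i : Fin (suc n)) {k} → unlast i ≡ just k → toℕ i ≡ toℕ k
toℕ-unlast {suc n} zero    refl = refl
toℕ-unlast {suc n} (suc i) eq with unlast i in eq′ | eq
... | just k | refl = cong suc (toℕ-unlast i eq′)

extendByZero : ∀ {m n} → Subset m n → Subset (suc m) (suc n)
extendByZero S (i , j) with unlast i | unlast j
... | just i′ | just j′ = S (i′ , j′)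
... | just _  | nothing = false
... | nothing | _       = false

extendByZero-inject₁ : ∀ {m n} (S : Subset m n) i j → extendByZero S (inject₁ i , inject₁ j) ≡ S (i , j)
extendByZero-inject₁ S i j rewrite unlast-inject₁ i | unlast-inject₁ j = refl

∈-extendByZero⁻ : ∀ {m n} (S : Subset m n) i j → T (extendByZero S (i , j)) →
                  ∃ λ i′ → ∃ λ j′ → toℕ i ≡ toℕ i′ × toℕ j ≡ toℕ j′ × T (S (i′ , j′))
∈-extendByZero⁻ S i j ∈S with unlast i in eqᵢ | unlast j in eqⱼ
... | just i′ | just j′ = i′ , j′ , toℕ-unlast i eqᵢ , toℕ-unlast j eqⱼ , ∈S

module _ (L : Lattice) where
  open Graph L

  -- Both graphs have the same vertices, and through `inject₁` every edge of the block survives in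
  -- the cylinder. The identity on subsets therefore preserves independence.
  cylinder≤plane : ∀ m n → #independent (H L (suc n) m) ≤ #block L (suc m) (suc n)
  cylinder≤plane m n = #independent-injection (H L (suc n) m) (block L 0 0 (suc m) (suc n)) id
    (λ ind (i , j) (i′ , j′) u∈ v∈ u~v → ind (i , j) (i′ , j′) u∈ v∈
      ((i , inject₁ j) , (i′ , inject₁ j′) , cong (i ,_) (wrap-inject₁ n j) , cong (i′ ,_) (wrap-inject₁ n j′) ,
       subst₂ (λ x y → (toℕ i , x) ~ (toℕ i′ , y)) (sym (Fin.toℕ-inject₁ j)) (sym (Fin.toℕ-inject₁ j′)) u~v))
    id

  torus≤cylinder : ∀ m n → #independent (S L (suc n) (suc m)) ≤ #independent (H L (suc n) m)
  torus≤cylinder m n = #independent-injection (S L (suc n) (suc m)) (H L (suc n) m) id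
    (λ { ind (i , j) (i′ , j′) u∈ v∈ ((k , l) , (k′ , l′) , refl , refl , e) →
      ind (i , j) (i′ , j′) u∈ v∈
        ((inject₁ k , wrap (suc n) l) , (inject₁ k′ , wrap (suc n) l′) ,
         cong (_, wrap (suc n) l) (wrap-inject₁ m k) , cong (_, wrap (suc n) l′) (wrap-inject₁ m k′) ,
         (inject₁ k , l) , (inject₁ k′ , l′) , refl , refl ,
         subst₂ (λ x y → (x , toℕ l) ~ (y , toℕ l′)) (sym (Fin.toℕ-inject₁ k)) (sym (Fin.toℕ-inject₁ k′)) e) })
    id

  -- The added row and column are empty, so no edge between chosen sites crosses either cut. Such an
  -- edge is then a translate of a pair inside the block, where independence makes the pair
  -- compatible.
  plane≤torus : Homogeneous L → ∀ m n → #block L m n ≤ #independent (S L (suc n) (suc m))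
  plane≤torus hom m n = #independent-injection (block L 0 0 m n) (S L (suc n) (suc m)) extendByZero
    (λ {X} → extend-independent {X})
    (λ {X} {X′} eq (i , j) → trans (sym (extendByZero-inject₁ X i j))
      (trans (eq (inject₁ i , inject₁ j)) (extendByZero-inject₁ X′ i j)))
    where
    open Homogeneous hom
    extend-independent : ∀ {X} → Independent (block L 0 0 m n) X → Independent (S L (suc n) (suc m)) (extendByZero X)
    extend-independent {X} ind _ _ u∈ v∈ (_ , _ , refl , refl , (i , j) , (i′ , j′) , refl , refl , e) =
      let a  , b  , i≡a   , j≡b   , ab∈   = ∈-extendByZero⁻ X (wrap (suc m) i) (wrap (suc n) j) u∈
          a′ , b′ , i′≡a′ , j′≡b′ , a′b′∈ = ∈-extendByZero⁻ X (wrap (suc m) i′) (wrap (suc n) j′) v∈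
          -- The images of both ends avoid the last line, so one offset s undoes the wrapping for
          -- both rows; likewise t for the columns.
          s , i≡ , i′≡ = unwrap m i i′ (rowwise e) (subst (_< m) (sym i≡a) (Fin.toℕ<n a))
                                                   (subst (_< m) (sym i′≡a′) (Fin.toℕ<n a′))
          t , j≡ , j′≡ = unwrap n j j′ (columnwise e) (subst (_< n) (sym j≡b) (Fin.toℕ<n b))
                                                      (subst (_< n) (sym j′≡b′) (Fin.toℕ<n b′))
          c = shift 0 s 0 t (independent-compatible (block L 0 0 m n) {X} {a , b} {a′ , b′} ind ab∈ a′b′∈)
      in not-adjacent L c (subst₂ _~_
           (cong₂ _,_ (trans i≡ (cong (s ℕ.+_) i≡a)) (trans j≡ (cong (t ℕ.+_) j≡b)))
           (cong₂ _,_ (trans i′≡ (cong (s ℕ.+_) i′≡a′)) (trans j′≡ (cong (t ℕ.+_) j′≡b′))) e)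

  plane≤cylinder : Homogeneous L → ∀ m n → #block L m n ≤ #independent (H L (suc n) m)
  plane≤cylinder hom m n = ℕ.≤-trans (plane≤torus hom m n) (torus≤cylinder m n)

  torus≤plane : ∀ m n → #independent (S L (suc n) (suc m)) ≤ #block L (suc m) (suc n)
  torus≤plane m n = ℕ.≤-trans (torus≤cylinder m n) (cylinder≤plane m n)

-- Convergence of the three rates

module _ {a : ℕ → ℕ → ℕ} (count : IsGridCount a) where
  open IsGridCount count
  open GridLimit count

  plane-limit : (v : (m n : ℕ) → ℕ) →
    (∀ m n → a m n ≤ v m n) → (∀ m n → v m n ≤ a (suc m) (suc n)) →
    (λ m n → root (v m n) (suc m * suc n)) ⟶ limit
  plane-limit v a≤v v≤a ε 0<ε = let N , within = sandwich ε 0<ε in N , λ m n m≥ n≥ →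
    within m n (v m n) m≥ n≥ (a≤v m n) (v≤a m n)

  cylinder-limit : (v : (m n : ℕ) .{{_ : NonZero n}} → ℕ) →
    (∀ m n → a m n ≤ v m (suc n)) → (∀ m n → v m (suc n) ≤ a (suc m) (suc n)) →
    (λ m n → root (v m n) (suc m * n) {{ℕ.m*n≢0 (suc m) n}}) ⟶ limit
  -- A circumference n + 1 corresponds to side n in `sandwich`, so the threshold rises by one.
  cylinder-limit v a≤v v≤a ε 0<ε = let N , within = sandwich ε 0<ε in suc N , λ { m (suc n) m≥ (s≤s n≥) →
    within m n (v m (suc n)) (ℕ.≤-trans (ℕ.n≤1+n N) m≥) n≥ (a≤v m n) (v≤a m n) }

  torus-limit : (v : (m n : ℕ) .{{_ : NonZero m}} .{{_ : NonZero n}} → ℕ) →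
    (∀ m n → a m n ≤ v (suc m) (suc n)) → (∀ m n → v (suc m) (suc n) ≤ a (suc m) (suc n)) →
    (λ m n → root (v m n) (m * n) {{ℕ.m*n≢0 m n}}) ⟶ limit
  torus-limit v a≤v v≤a ε 0<ε = let N , within = sandwich ε 0<ε in suc N , λ { (suc m) (suc n) (s≤s m≥) (s≤s n≥) →
    within m n (v (suc m) (suc n)) m≥ n≥ (a≤v m n) (v≤a m n) }

planeCount : Lattice → (m n : ℕ) → ℕ
planeCount L m n = #independent (G L m n)

cylinderCount : Lattice → (m n : ℕ) .{{_ : NonZero n}} → ℕ
cylinderCount L m n {{n≢0}} = #independent (H L n m {{n≢0}})

torusCount : Lattice → (m n : ℕ) .{{_ : NonZero m}} .{{_ : NonZero n}} → ℕ
torusCount L m n {{m≢0}} {{n≢0}} = #independent (S L n m {{n≢0}} {{m≢0}})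

planeCount≡#block : ∀ L m n → planeCount L m n ≡ #block L (suc m) (suc n)
planeCount≡#block L m n = cong #independent G≡block
  where
  G≡block : G L m n ≡ block L 0 0 (suc m) (suc n)
  G≡block = refl

theorem2p2 : (L : Lattice) (t : TransferMultiplicityOne L) →
    (∀ (m : ℕ) .{{_ : NonZero m}} → (columnMatrix t m ≈ rowMatrix t m) × IsSymmetric (columnMatrix t m)) →
    Σ ℝ λ ℓ →
    ((λ m n → rate (G L m n)) ⟶ ℓ) ×
    ((λ m n → rate (H L n m)) ⟶ ℓ) ×
    ((λ m n → rate (S L n m)) ⟶ ℓ)
theorem2p2 L t _ = GridLimit.limit count , plane-limit count (planeCount L) 
    -- The plane count equals the upper end a(m+1,n+1) of the sandwich; the lower bound is
    -- monotonicity.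
    (λ m n → subst (#block L m n ≤_) (sym (planeCount≡#block L m n)) (IsGridCount.monotone count {m} {suc m} {n} {suc n} (ℕ.n≤1+n m) (ℕ.n≤1+n n)))
    (λ m n → ℕ.≤-reflexive (planeCount≡#block L m n)) , cylinder-limit count (cylinderCount L) (plane≤cylinder L hom) (cylinder≤plane L) , torus-limit count (torusCount L) (plane≤torus L hom) (torus≤plane L)
  where
  hom   = homogeneous t
  count = isGridCount hom
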